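{- Let $p,q\ge1$ be integers and let $K^0_{p,q}$ be the complete tripartite graph with parts $P=\{v^p_1,\dots,v^p_p\}$, $Q=\{v^q_1,\dots,v^q_q\}$ and $\{v_0\}$, where $v_0$ is the sink. Then $\mathrm{PPF}_{p,q}=\mathrm{PPF}(K^0_{p,q})$, where functions $f:P\cup Q\to\mathbb N$ are identified with pairs $(f^p;f^q)=(f(v^p_1),\dots,f(v^p_p);f(v^q_1),\dots,f(v^q_q))$. In particular, $|\mathrm{PPF}(K^0_{p,q})|=|\mathrm{PPF}_{p,q}|=p^q(q-1)^{p-1}+q^p(p-1)^{q-1}-(p+q-1)(p-1)^{q-1}(q-1)^{p-1}$.
   Context: $K^0_{p,q}$ is a simple graph with a single edge between any two vertices lying in different parts among $P$, $Q$, $\{v_0\}$ and no other edges; its sink is $v_0$. $\mathbb N=\{1,2,\dots\}$. For a graph $H$ (finite multigraph, no loops) with sink $s$, vertex set $V_H$, non-sink vertex set $\tilde V_H$, write $\deg^A(v)=\sum_{w\in A}\mathrm{mult}(vw)$ where $\mathrm{mult}(vw)$ is the number of edges between $v,w$. An $H$-parking function is $f:\tilde V_H\to\mathbb N$ such that every non-empty $S\subseteq\tilde V_H$ contains $v$ with $f(v)\le\deg^{V_H\setminus S}(v)$; $\mathrm{PF}(H)$ is their set. For $G=K^0_{p,q}$, $\tilde V=P\cup Q$, and $A\subseteq\tilde V$, let $G^A$ be the induced subgraph on $A\cup\{v_0\}$ with sink $v_0$. For $f\in\mathrm{PF}(G)$ and an ordered partition $(A,B)$ of $\tilde V$ with $A,B\neq\emptyset$,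 set $f^A=f|_A$ and $f^B(v)=f(v)-\deg^A(v)$ for $v\in B$; $f$ is decomposable w.r.t. $(A,B)$ if $f^A\in\mathrm{PF}(G^A)$ and $f^B\in\mathrm{PF}(G^B)$; $f$ is prime if it is decomposable w.r.t. no such partition; $\mathrm{PPF}(G)$ is the set of prime $G$-parking functions. Lattice paths: for non-decreasing $\mathbf a=(a_1,\dots,a_p)\in\{0,\dots,q\}^p$ and $\mathbf b=(b_1,\dots,b_q)\in\{0,\dots,p\}^q$, $\mathcal L^\perp_{\mathbf a}$ is the lattice path from $(0,0)$ to $(p,q)$ with steps $E=(1,0)$, $N=(0,1)$ whose $i$-th $E$ step is at $y$-coordinate $a_i$, and $\mathcal L_{\mathbf b}$ is the path from $(0,0)$ to $(p,q)$ whose $j$-th $N$ step is at $x$-coordinate $b_j$. A path $\mathcal L$ lies weakly above $\mathcal L'$ if for each $i\in[p]$ the $y$-coordinate of the $i$-th $E$ step of $\mathcal L$ is at least that of the $i$-th $E$ step of $\mathcal L'$. For a vector $x$, $\mathrm{inc}(x)$ is its non-decreasing rearrangement and $\mathbf 1$ the all-ones vector. A $(p,q)$-parking function is $f=(f^p;f^q)$ with $f^p\in[q+1]^p$, $f^q\in[p+1]^q$ such that, with $\mathbf a=\mathrm{inc}(f^p)-\mathbf 1$ and $\mathbf b=\mathrm{inc}(f^q)-\mathbf 1$, the path $\mathcal L_{\mathbf b}$ lies weakly above $\mathcal L^\perp_{\mathbf a}$. Such $f$ is a prime $(p,q)$-parking function if moreover $\mathcal L^\perp_{\mathbf a}$ and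 $\mathcal L_{\mathbf b}$ intersect only at $(0,0)$ and $(p,q)$; $\mathrm{PPF}_{p,q}$ denotes the set of prime $(p,q)$-parking functions. -}

module Defs where

open import Data.Bool using (Bool; true; false; if_then_else_; _∧_; not; _xor_)
open import Data.Nat using (ℕ; zero; suc; _+_; _∸_; _≤_; _<ᵇ_)
open import Data.Nat.Properties using (≤-decTotalOrder)
open import Data.Fin using (Fin; toℕ)
open import Data.Fin.Subset using (Subset; _∈_; _⊆_; Nonempty; ∁; ⊤)
open import Data.Vec using (Vec; lookup; tabulate; sum; _++_; toList)
open import Data.List using (List; []; _∷_; replicate; map; length)
import Data.List as L
open import Data.List.Relation.Unary.All using (All)
open import Data.List.Relation.Binary.Pointwise using (Pointwise)
open import Data.List.Membership.Propositional using () renaming (_∈_ to _∈ₗ_)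
open import Data.Product using (Σ; ∃; _×_; _,_)
open import Data.Sum using (_⊎_)
open import Relation.Binary.PropositionalEquality using (_≡_)
open import Relation.Nullary using (¬_)
open import Data.List.Sort ≤-decTotalOrder using (sort)

-- Graphs with a sink.
-- A finite loopless multigraph H with sink s and non-sink vertices Fin n
-- is given by  mult : Fin n → Fin n → ℕ  (edge multiplicities between
-- non-sink vertices; mult v v = 0 for no loops) and
-- sinkMult : Fin n → ℕ  (multiplicity of the edge v s).
--
-- For A ⊆ Fin n, the induced subgraph H^A on A ∪ {s} (sink s) is treated
-- without re-indexing: functions are on all of Fin n, only values on A matter.

module SinkGraph {n : ℕ} (mult : Fin n → Fin n → ℕ) (sinkMult : Fin n → ℕ) where

  degOutside : Subset n → Subset n → Fin n → ℕ
  degOutside A S v =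
    sinkMult v + sum (tabulate λ w → if lookup A w ∧ not (lookup S w) then mult v w else 0)

  degInto : Subset n → Fin n → ℕ
  degInto A v = sum (tabulate λ w → if lookup A w then mult v w else 0)

  -- f restricted to A is an H^A-parking function (values in ℕ = {1,2,...})
  IsPFOn : Subset n → (Fin n → ℕ) → Set
  IsPFOn A f =
    (∀ v → v ∈ A → 1 ≤ f v) ×
    (∀ S → S ⊆ A → Nonempty S → ∃ λ v → v ∈ S × f v ≤ degOutside A S v)

  IsPF : (Fin n → ℕ) → Set
  IsPF f = IsPFOn ⊤ f

  -- decomposable w.r.t. the ordered partition (A , ∁ A);
  -- f^B(v) = f(v) - deg^A(v) (truncated subtraction: if this is ≤ 0 then
  -- f^B is not ℕ-valued, and indeed IsPFOn fails since it demands 1 ≤ f^B v)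
  Decomposable : (Fin n → ℕ) → Subset n → Set
  Decomposable f A = IsPFOn A f × IsPFOn (∁ A) (λ v → f v ∸ degInto A v)

  IsPrimePF : (Fin n → ℕ) → Set
  IsPrimePF f = IsPF f × (∀ A → Nonempty A → Nonempty (∁ A) → ¬ Decomposable f A)

-- The graph K⁰_{p,q}: non-sink vertices Fin (p + q); vertex i lies in P
-- (i = v^p_{i+1}) if toℕ i < p, otherwise in Q (i = v^q_{i-p+1}).

inP : (p q : ℕ) → Fin (p + q) → Bool
inP p q i = toℕ i <ᵇ p

Kmult : (p q : ℕ) → Fin (p + q) → Fin (p + q) → ℕ
Kmult p q i j = if inP p q i xor inP p q j then 1 else 0

Ksink : (p q : ℕ) → Fin (p + q) → ℕ
Ksink p q i = 1

pairToFun : {p q : ℕ} → Vec ℕ p → Vec ℕ q → Fin (p + q) → ℕ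
pairToFun fp fq = lookup (fp ++ fq)

IsPPF-K : (p q : ℕ) → Vec ℕ p → Vec ℕ q → Set
IsPPF-K p q fp fq = SinkGraph.IsPrimePF (Kmult p q) (Ksink p q) (pairToFun fp fq)

data Step : Set where
  E N : Step

Path : Set
Path = List Step

-- L^⊥_a from (0,0) to (p,q) (for non-decreasing a with entries in {0..q}):
-- the i-th E step is at y-coordinate a_i.
perpPath : ℕ → List ℕ → Path
perpPath q a = go 0 a
  where
  go : ℕ → List ℕ → Path
  go y []       = replicate (q ∸ y) N
  go y (x ∷ xs) = replicate (x ∸ y) N L.++ (E ∷ go x xs)

-- L_b from (0,0) to (p,q) (for non-decreasing b with entries in {0..p}):
-- the j-th N step is at x-coordinate b_j.
path : ℕ → List ℕ → Path
path p b = go 0 b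
  where
  go : ℕ → List ℕ → Path
  go x []       = replicate (p ∸ x) E
  go x (y ∷ ys) = replicate (y ∸ x) E L.++ (N ∷ go y ys)

eYs : Path → List ℕ
eYs = go 0
  where
  go : ℕ → Path → List ℕ
  go y []       = []
  go y (E ∷ s)  = y ∷ go y s
  go y (N ∷ s)  = go (suc y) s

points : Path → List (ℕ × ℕ)
points = go 0 0
  where
  go : ℕ → ℕ → Path → List (ℕ × ℕ)
  go x y []      = (x , y) ∷ []
  go x y (E ∷ s) = (x , y) ∷ go (suc x) y s
  go x y (N ∷ s) = (x , y) ∷ go x (suc y) s

WeaklyAbove : Path → Path → Set
WeaklyAbove L L' = Pointwise (λ y y' → y' ≤ y) (eYs L) (eYs L')

inc : List ℕ → List ℕ
inc = sort

module _ (p q : ℕ) (fp : Vec ℕ p) (fq : Vec ℕ q) where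

  aVec : List ℕ
  aVec = map (λ x → x ∸ 1) (inc (toList fp))

  bVec : List ℕ
  bVec = map (λ x → x ∸ 1) (inc (toList fq))

  IsPFpq : Set
  IsPFpq =
    All (λ x → 1 ≤ x × x ≤ suc q) (toList fp) ×
    All (λ x → 1 ≤ x × x ≤ suc p) (toList fq) ×
    WeaklyAbove (path p bVec) (perpPath q aVec)

  IsPPFpq : Set
  IsPPFpq =
    IsPFpq ×
    (∀ pt → pt ∈ₗ points (perpPath q aVec) → pt ∈ₗ points (path p bVec) →
       pt ≡ (0 , 0) ⊎ pt ≡ (p , q))

{-# OPTIONS --safe #-}
module Submission where

open import Defs
open import Data.Bool using (Bool; true; false; if_then_else_; _∧_; not; T)
open import Data.Bool.Properties using (T?; not-involutive)
open import Data.Nat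
open import Data.Nat.Properties
open import Data.Nat.ListAction using (sum)
open import Data.Nat.ListAction.Properties using (sum-++)
open import Data.Nat.Tactic.RingSolver using (solve-∀)
open import Data.Integer using (ℤ; +_; _-_; 1ℤ)
import Data.Integer as ℤ
import Data.Integer.Properties as ℤ
import Data.Integer.Tactic.RingSolver as ℤ
open import Data.Fin using (Fin; zero; suc; _↑ˡ_; _↑ʳ_; splitAt; toℕ)
open import Data.Fin.Properties using (splitAt⁻¹-↑ˡ; splitAt⁻¹-↑ʳ; toℕ-↑ˡ; toℕ-↑ʳ; toℕ<n)
open import Data.Fin.Subset using (Subset; ∁; ⊤; Nonempty) renaming (_∈_ to _∈ₛ_; _⊆_ to _⊆ₛ_)
open import Data.Fin.Subset.Properties using (∈⊤)
open import Data.Vec using (Vec; []; _∷_; lookup; tabulate; toList)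
import Data.Vec as Vec
open import Data.Vec.Properties using (lookup-++ˡ; lookup-++ʳ; lookup∘tabulate; tabulate-cong; []=⇒lookup; lookup⇒[]=; lookup-map; lookup-replicate; ∷-injective; length-toList)
open import Data.List using (List; []; _∷_; length; null; map; applyUpTo; replicate; _++_; filter; cartesianProductWith; cartesianProduct)
open import Data.List.Properties using (++-identityʳ; map-replicate; map-++; length-map; map-∘; map-cong)
open import Data.List.Sort ≤-decTotalOrder using (sort; sort-↭; sort-↗)
open import Data.List.Membership.Propositional using (_∈_)
open import Data.List.Membership.Propositional.Properties
open import Data.List.Relation.Unary.Any using (here; there)
open import Data.List.Relation.Unary.All using (All; []; _∷_)
import Data.List.Relation.Unary.All as All
import Data.List.Relation.Unary.All.Properties as All
open import Data.List.Relation.Unary.AllPairs using (AllPairs; []; _∷_)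
import Data.List.Relation.Unary.AllPairs as AllPairs
import Data.List.Relation.Unary.AllPairs.Properties as AllPairs
open import Data.List.Relation.Unary.Sorted.TotalOrder.Properties using (Sorted⇒AllPairs)
open import Data.List.Relation.Unary.Unique.Propositional using (Unique)
import Data.List.Relation.Unary.Unique.Propositional.Properties as Unique
open import Data.List.Relation.Binary.Pointwise using (Pointwise; []; _∷_)
open import Data.List.Relation.Binary.Permutation.Propositional using (_↭_; ↭-sym)
import Data.List.Relation.Binary.Permutation.Propositional as ↭
open import Data.List.Relation.Binary.Permutation.Propositional.Properties using (↭-length; All-resp-↭) renaming (map⁺ to ↭-map⁺)
open import Data.Product using (∃; _×_; _,_; proj₁; proj₂; swap)
open import Data.Sum using (_⊎_; inj₁; inj₂)
open import Data.Empty using (⊥; ⊥-elim)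
open import Data.Unit using (tt)
open import Function.Base using (_∘_; case_of_)
open import Function.Bundles using (_⇔_; mk⇔; Equivalence)
open import Relation.Nullary using (¬_; yes; no; contradiction)
open import Relation.Nullary.Decidable using (_×-dec_)
open import Relation.Binary.PropositionalEquality

-- Write a = f^p - 1, b = f^q - 1 and let cnt t c be the number of entries of c below t.
-- Both notions of primality say that f is positive and that at every (x , y) in
-- [0,p] × [0,q] other than the two corners (0,0), (p,q) one has x < cnt y a or y < cnt x b.
-- On the lattice side, a point violating this lies on both paths once L_b is weakly above L^⊥_a.
-- On the graph side, it yields a decomposition whose first block consists of x vertices
-- of P with smallest labels and y vertices of Q with smallest labels.
--
-- For the count, remove one zero from a and one from b and run the burning process in which
-- s vertices of P and t of Q are alight, and burning up a vertex of one part sets alight the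
-- vertices of the other part with label zero and decrements the other labels. With m and n
-- vertices not yet reached, the number of labellings that burn completely is
-- (m+s)ⁿ (n+t)ᵐ - n (m+s)ⁿ⁻¹ m (n+t)ᵐ⁻¹, by induction along the process and the binomial theorem.

-- Threshold counts and the burning process.

⟦_⟧ : Bool → ℕ
⟦ c ⟧ = if c then 1 else 0

cnt : ℕ → List ℕ → ℕ
cnt t []      = 0
cnt t (v ∷ a) = ⟦ v <ᵇ t ⟧ + cnt t a

rest : List ℕ → List ℕ
rest []          = []
rest (zero ∷ a)  = rest a
rest (suc v ∷ a) = v ∷ rest a

private
  +-swap : ∀ x y z → x + (y + z) ≡ y + (x + z)
  +-swap = solve-∀

  +-rotate : ∀ x y z → x + (y + z) ≡ (y + x) + z
  +-rotate = solve-∀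

  +-interchange : ∀ x y z w → (x + y) + (z + w) ≡ (x + z) + (y + w)
  +-interchange = solve-∀

cnt-suc : ∀ t a → cnt (suc t) a ≡ cnt 1 a + cnt t (rest a)
cnt-suc t []          = refl
cnt-suc t (zero ∷ a)  = cong suc (cnt-suc t a)
cnt-suc t (suc v ∷ a) = begin
  ⟦ v <ᵇ t ⟧ + cnt (suc t) a             ≡⟨ cong (_+_ ⟦ v <ᵇ t ⟧) (cnt-suc t a) ⟩
  ⟦ v <ᵇ t ⟧ + (cnt 1 a + cnt t (rest a)) ≡⟨ +-swap ⟦ v <ᵇ t ⟧ (cnt 1 a) _ ⟩
  cnt 1 a + (⟦ v <ᵇ t ⟧ + cnt t (rest a)) ∎
  where open ≡-Reasoning

cnt-zero : ∀ a → cnt 0 a ≡ 0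
cnt-zero []      = refl
cnt-zero (v ∷ a) = cnt-zero a

length-rest : ∀ a → cnt 1 a + length (rest a) ≡ length a
length-rest []          = refl
length-rest (zero ∷ a)  = cong suc (length-rest a)
length-rest (suc v ∷ a) = trans (+-suc (cnt 1 a) _) (cong suc (length-rest a))

-- The first argument is fuel; the last two count the vertices of P and of Q that are alight.
burn : ℕ → List ℕ → List ℕ → ℕ → ℕ → Bool
burn zero    a b s       t       = null a ∧ null b
burn (suc ℓ) a b zero    zero    = null a ∧ null b
burn (suc ℓ) a b zero    (suc t) = burn ℓ (rest a) b (cnt 1 a) t
burn (suc ℓ) a b (suc s) t       = burn ℓ a (rest b) s (cnt 1 b + t)

-- (x , y) counts the vertices of P and of Q burnt up from now on: the process never stalls early.
Good : List ℕ → List ℕ → ℕ → ℕ → Set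
Good a b s t = ∀ x y → x ≤ length a + s → y ≤ length b + t →
  ¬ (x ≡ length a + s × y ≡ length b + t) → x < cnt y a + s ⊎ y < cnt x b + t

private
  total-rest : ∀ b t → length (rest b) + (cnt 1 b + t) ≡ length b + t
  total-rest b t = trans (+-rotate (length (rest b)) (cnt 1 b) t) (cong (_+ t) (length-rest b))

  cnt-rest : ∀ x b t → cnt x (rest b) + (cnt 1 b + t) ≡ cnt (suc x) b + t
  cnt-rest x b t = trans (+-rotate (cnt x (rest b)) (cnt 1 b) t) (cong (_+ t) (sym (cnt-suc x b)))

-- The two parts play symmetric roles, so the steps that burn up a vertex of Q are obtained from
-- those for P.
Good-swap : ∀ a b s t → Good a b s t → Good b a t s
Good-swap a b s t g x y x≤ y≤ ≢ with g y x y≤ x≤ (λ (p , q) → ≢ (q , p))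
... | inj₁ l = inj₂ l
... | inj₂ l = inj₁ l

-- Burning up one vertex of P moves the origin: the point `(x , y)` of the new state is
-- `(suc x , y)` of the old one. The total for Q is unchanged, since newly lit vertices only move
-- from `b` into the count of those alight.
Good-step⇒ : ∀ a b s t → Good a b (suc s) t → Good a (rest b) s (cnt 1 b + t)
Good-step⇒ a b s t g x y x≤ y≤ ≢
  rewrite total-rest b t | cnt-rest x b t
  with g (suc x) y (subst (suc x ≤_) (sym (+-suc (length a) s)) (s≤s x≤)) y≤
         (λ (p , q) → ≢ (suc-injective (trans p (+-suc (length a) s)) , q))
... | inj₁ l = inj₁ (s≤s⁻¹ (subst (suc x <_) (+-suc (cnt y a) s) l))
... | inj₂ l = inj₂ l

Good-step⇐ : ∀ a b s t → Good a (rest b) s (cnt 1 b + t) → Good a b (suc s) t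
-- Points with `x = 0` do not come from the new state; here a vertex of P that is alight gives the
-- inequality.
Good-step⇐ a b s t g zero y x≤ y≤ ≢ = inj₁ (subst (0 <_) (sym (+-suc (cnt y a) s)) (s≤s z≤n))
Good-step⇐ a b s t g (suc x) y x≤ y≤ ≢
  with g x y (s≤s⁻¹ (subst (suc x ≤_) (+-suc (length a) s) x≤))
         (subst (y ≤_) (sym (total-rest b t)) y≤)
         (λ (p , q) → ≢ (trans (cong suc p) (sym (+-suc (length a) s)) , trans q (total-rest b t)))
... | inj₁ l = inj₁ (subst (suc x <_) (sym (+-suc (cnt y a) s)) (s≤s l))
... | inj₂ l = inj₂ (subst (y <_) (cnt-rest x b t) l)

-- With nothing alight both inequalities fail at `(0 , 0)`, so this point has to be the exempt end
-- point.
Good-00⇒ : ∀ a b → Good a b 0 0 → T (null a ∧ null b)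
Good-00⇒ [] [] g = tt
Good-00⇒ [] (w ∷ b) g with g 0 0 z≤n z≤n (λ { (_ , ()) })
... | inj₂ l rewrite cnt-zero b with () ← l
Good-00⇒ (v ∷ a) b g with g 0 0 z≤n z≤n (λ { (() , _) })
... | inj₁ l rewrite cnt-zero a with () ← l
... | inj₂ l rewrite cnt-zero b with () ← l

Good-00⇐ : ∀ a b → T (null a ∧ null b) → Good a b 0 0
Good-00⇐ [] [] g zero zero z≤n z≤n ≢ = ⊥-elim (≢ (refl , refl))

private
  step-≤ : ∀ {ℓ} (a b : List ℕ) s t → length a + suc s + (length b + t) ≤ suc ℓ →
    length a + s + (length (rest b) + (cnt 1 b + t)) ≤ ℓ
  step-≤ {ℓ} a b s t h rewrite total-rest b t =
    s≤s⁻¹ (subst (λ z → z + (length b + t) ≤ suc ℓ) (+-suc (length a) s) h)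

  step-≤′ : ∀ {ℓ} (a b : List ℕ) t → length a + 0 + (length b + suc t) ≤ suc ℓ →
    length (rest a) + cnt 1 a + (length b + t) ≤ ℓ
  step-≤′ {ℓ} a b t h =
    s≤s⁻¹ (subst (_≤ suc ℓ) (trans (cong₂ _+_ (trans (+-identityʳ (length a)) (sym eq)) (+-suc (length b) t)) (+-suc _ _)) h)
    where
    eq : length (rest a) + cnt 1 a ≡ length a
    eq = trans (+-comm (length (rest a)) _) (length-rest a)

-- The fuel bounds the number of vertices not yet burnt up. This number drops by one in each step,
-- so the fuel cannot run out before the process ends.
burn⇒Good : ∀ ℓ a b s t → length a + s + (length b + t) ≤ ℓ → T (burn ℓ a b s t) → Good a b s t
burn⇒Good zero [] [] zero zero h g = Good-00⇐ [] [] g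
burn⇒Good (suc ℓ) a b zero zero h g = Good-00⇐ a b g
burn⇒Good (suc ℓ) a b zero (suc t) h g =
  -- With no vertex of P alight a vertex of Q burns up: this is the step for P with the parts
  -- exchanged.
  Good-swap b a _ _ (Good-step⇐ b a t 0 (subst (Good b (rest a) t) (sym (+-identityʳ _))
    (Good-swap (rest a) b _ _ (burn⇒Good ℓ (rest a) b (cnt 1 a) t (step-≤′ a b t h) g))))
burn⇒Good (suc ℓ) a b (suc s) t h g =
  Good-step⇐ a b s t (burn⇒Good ℓ a (rest b) s (cnt 1 b + t) (step-≤ a b s t h) g)

Good⇒burn : ∀ ℓ a b s t → length a + s + (length b + t) ≤ ℓ → Good a b s t → T (burn ℓ a b s t)
Good⇒burn zero [] [] zero zero h g = tt
Good⇒burn (suc ℓ) a b zero zero h g = Good-00⇒ a b g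
Good⇒burn (suc ℓ) a b zero (suc t) h g =
  Good⇒burn ℓ (rest a) b (cnt 1 a) t (step-≤′ a b t h)
    (Good-swap b (rest a) _ _ (subst (Good b (rest a) t) (+-identityʳ _)
      (Good-step⇒ b a t 0 (Good-swap a b _ _ g))))
Good⇒burn (suc ℓ) a b (suc s) t h g =
  Good⇒burn ℓ a (rest b) s (cnt 1 b + t) (step-≤ a b s t h) (Good-step⇒ a b s t g)

-- Sums over words and the number of labellings that burn completely.

Σ< : ℕ → (ℕ → ℕ) → ℕ
Σ< zero    f = 0
Σ< (suc K) f = f 0 + Σ< K (f ∘ suc)

∑ : ℕ → ℕ → (List ℕ → ℕ) → ℕ
∑ K zero    F = F []
∑ K (suc n) F = Σ< K λ w → ∑ K n λ a → F (w ∷ a)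

-- Bin n h = Σ_k (n choose k) h k (n - k)
Bin : ℕ → (ℕ → ℕ → ℕ) → ℕ
Bin zero    h = h 0 0
Bin (suc n) h = Bin n (λ k r → h (suc k) r) + Bin n (λ k r → h k (suc r))

Σ<-cong : ∀ K {f g : ℕ → ℕ} → (∀ w → f w ≡ g w) → Σ< K f ≡ Σ< K g
Σ<-cong zero    eq = refl
Σ<-cong (suc K) eq = cong₂ _+_ (eq 0) (Σ<-cong K (eq ∘ suc))

Σ<-+ : ∀ K f g → Σ< K (λ w → f w + g w) ≡ Σ< K f + Σ< K g
Σ<-+ zero    f g = refl
Σ<-+ (suc K) f g = trans (cong (_+_ _) (Σ<-+ K (f ∘ suc) (g ∘ suc))) (+-interchange (f 0) _ _ _)

Σ<-0 : ∀ K → Σ< K (λ _ → 0) ≡ 0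
Σ<-0 zero    = refl
Σ<-0 (suc K) = Σ<-0 K

∑-cong : ∀ K n {F G : List ℕ → ℕ} → (∀ a → F a ≡ G a) → ∑ K n F ≡ ∑ K n G
∑-cong K zero    eq = eq []
∑-cong K (suc n) eq = Σ<-cong K λ w → ∑-cong K n λ a → eq (w ∷ a)

∑-+ : ∀ K n F G → ∑ K n (λ a → F a + G a) ≡ ∑ K n F + ∑ K n G
∑-+ K zero    F G = refl
∑-+ K (suc n) F G = trans (Σ<-cong K λ w → ∑-+ K n _ _) (Σ<-+ K _ _)

∑-0 : ∀ K n → ∑ K n (λ _ → 0) ≡ 0
∑-0 K zero    = refl
∑-0 K (suc n) = trans (Σ<-cong K λ w → ∑-0 K n) (Σ<-0 K)

Bin-cong : ∀ n {h h′ : ℕ → ℕ → ℕ} → (∀ k r → k + r ≡ n → h k r ≡ h′ k r) → Bin n h ≡ Bin n h′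
Bin-cong zero    eq = eq 0 0 refl
Bin-cong (suc n) eq = cong₂ _+_
  (Bin-cong n λ k r e → eq (suc k) r (cong suc e))
  (Bin-cong n λ k r e → eq k (suc r) (trans (+-suc k r) (cong suc e)))

Bin-+ : ∀ n h h′ → Bin n (λ k r → h k r + h′ k r) ≡ Bin n h + Bin n h′
Bin-+ zero    h h′ = refl
Bin-+ (suc n) h h′ = trans (cong₂ _+_ (Bin-+ n _ _) (Bin-+ n _ _)) (+-interchange (Bin n _) _ _ _)

Bin-* : ∀ n c h → Bin n (λ k r → c * h k r) ≡ c * Bin n h
Bin-* zero    c h = refl
Bin-* (suc n) c h = trans (cong₂ _+_ (Bin-* n c _) (Bin-* n c _)) (sym (*-distribˡ-+ c _ _))

Σ<-Bin : ∀ K n (h : ℕ → ℕ → ℕ → ℕ) →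
  Σ< K (λ w → Bin n (h w)) ≡ Bin n (λ k r → Σ< K λ w → h w k r)
Σ<-Bin K zero    h = refl
Σ<-Bin K (suc n) h = trans (Σ<-+ K _ _) (cong₂ _+_ (Σ<-Bin K n _) (Σ<-Bin K n _))

∑-Bin : ∀ K m n (h : List ℕ → ℕ → ℕ → ℕ) →
  ∑ K m (λ a → Bin n (h a)) ≡ Bin n (λ k r → ∑ K m λ a → h a k r)
∑-Bin K m zero    h = refl
∑-Bin K m (suc n) h = trans (∑-+ K m _ _) (cong₂ _+_ (∑-Bin K m n _) (∑-Bin K m n _))

-- A word is determined by the positions of its zeros and by what is left after deleting them and
-- decrementing. The choice of positions accounts for the binomial coefficient.
∑-rest : ∀ K n (F : ℕ → List ℕ → ℕ) →
  ∑ (suc K) n (λ a → F (cnt 1 a) (rest a)) ≡ Bin n (λ k r → ∑ K r (F k))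
∑-rest K zero    F = refl
∑-rest K (suc n) F = cong₂ _+_ (∑-rest K n (F ∘ suc))
  (trans (Σ<-cong K λ w → ∑-rest K n λ k a → F k (w ∷ a)) (Σ<-Bin K n _))

-- D n A = n A^(n-1)
D : ℕ → ℕ → ℕ
D zero    A = 0
D (suc n) A = A ^ n + A * D n A

D-suc : ∀ n A → D (suc n) A ≡ suc n * A ^ n
D-suc zero    A = cong suc (*-zeroʳ A)
D-suc (suc n) A = trans (cong (λ d → A ^ suc n + A * d) (D-suc n A)) (lem A (A ^ n) n)
  where
  lem : ∀ A B n → A * B + A * (suc n * B) ≡ suc (suc n) * (A * B)
  lem = solve-∀

-- The binomial theorem for `1 + A`.
Bin-^ : ∀ n A → Bin n (λ k r → A ^ r) ≡ suc A ^ n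
Bin-^ zero    A = refl
Bin-^ (suc n) A = cong₂ _+_ (Bin-^ n A) (trans (Bin-* n A _) (cong (A *_) (Bin-^ n A)))

-- The derivative of `Bin-^` with respect to `A`; the recursion of `D` is the product rule.
Bin-D : ∀ n A → Bin n (λ k r → D r A) ≡ D n (suc A)
Bin-D zero    A = refl
Bin-D (suc n) A
  rewrite Bin-+ n (λ k r → A ^ r) (λ k r → A * D r A) | Bin-* n A (λ k r → D r A)
        | Bin-^ n A | Bin-D n A = lem (D n (suc A)) (suc A ^ n) A
  where
  lem : ∀ d P A → d + (P + A * d) ≡ P + (d + A * d)
  lem = solve-∀

burnt : ℕ → ℕ → ℕ → ℕ → ℕ → ℕ
burnt ℓ m n s t = ∑ (n + t) m λ a → ∑ (m + s) n λ b → ⟦ burn ℓ a b s t ⟧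

private
  -- With nothing alight only the empty labelling succeeds. For `m` and `n` positive the sum is
  -- therefore 0, and the correction term alone, n mⁿ⁻¹ m nᵐ⁻¹, equals the right-hand side.
  null-count : ∀ m n K M →
    ∑ K m (λ a → ∑ M n λ b → ⟦ null a ∧ null b ⟧) + D n m * D m n ≡ m ^ n * n ^ m
  null-count zero    zero    K M = refl
  null-count zero    (suc n) K M
    rewrite Σ<-cong M (λ w → ∑-0 M n) | Σ<-0 M = *-zeroʳ (D (suc n) 0)
  null-count (suc m) zero    K M
    rewrite Σ<-cong K (λ w → ∑-0 K m) | Σ<-0 K = refl
  null-count (suc m) (suc n) K M
    rewrite Σ<-cong K (λ w → trans (∑-cong K m λ a → ∑-0 M (suc n)) (∑-0 K m)) | Σ<-0 K
          | D-suc n (suc m) | D-suc m (suc n) = lem (suc n) (suc m) (suc m ^ n) (suc n ^ m)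
    where
    lem : ∀ n m X Y → n * X * (m * Y) ≡ m * X * (n * Y)
    lem = solve-∀

-- No subtraction: for m , n ≥ 1 this reads (m+s)ⁿ⁻¹ (n+t)ᵐ⁻¹ ((m+s)(n+t) - mn).
burnt-count : ∀ ℓ m n s t → m + s + (n + t) ≤ ℓ →
  burnt ℓ m n s t + D n (m + s) * D m (n + t) ≡ (m + s) ^ n * (n + t) ^ m
burnt-count zero zero zero zero zero h = refl
burnt-count (suc ℓ) m n zero zero h
  rewrite +-identityʳ m | +-identityʳ n = null-count m n n m
-- Of the `m` unreached vertices of P, the `k` with label zero catch fire and `r` remain. Since
-- `r + k` is again `m`, the factors `m ^ n` and `D n m` are constants of the binomial sum, and only
-- powers and derivatives in `n + t` are summed.
burnt-count (suc ℓ) m n zero (suc t) h rewrite +-identityʳ m | +-suc n t = begin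
  ∑ (suc (n + t)) m (λ a → ∑ m n λ b → ⟦ burn ℓ (rest a) b (cnt 1 a) t ⟧) + D n m * D m (suc (n + t))
    ≡⟨ cong₂ _+_ (trans (∑-rest (n + t) m (λ k a → ∑ m n λ b → ⟦ burn ℓ a b k t ⟧))
                        (Bin-cong m λ k r e → cong (λ M → ∑ (n + t) r λ a → ∑ M n λ b → ⟦ burn ℓ a b k t ⟧)
                                                   (trans (sym e) (+-comm k r))))
                 (sym (trans (Bin-* m (D n m) _) (cong (D n m *_) (Bin-D m (n + t))))) ⟩
  Bin m (λ k r → burnt ℓ r n k t) + Bin m (λ k r → D n m * D r (n + t))
    ≡⟨ sym (Bin-+ m _ _) ⟩
  Bin m (λ k r → burnt ℓ r n k t + D n m * D r (n + t))
    ≡⟨ Bin-cong m step ⟩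
  Bin m (λ k r → m ^ n * (n + t) ^ r)
    ≡⟨ trans (Bin-* m (m ^ n) _) (cong (m ^ n *_) (Bin-^ m (n + t))) ⟩
  m ^ n * suc (n + t) ^ m ∎
  where
  open ≡-Reasoning
  step : ∀ k r → k + r ≡ m → burnt ℓ r n k t + D n m * D r (n + t) ≡ m ^ n * (n + t) ^ r
  step k r refl rewrite +-comm k r =
    burnt-count ℓ r n k t (s≤s⁻¹ (subst (_≤ suc ℓ) (+-suc (r + k) (n + t)) h))
burnt-count (suc ℓ) m n (suc s) t h rewrite +-suc m s = begin
  ∑ (n + t) m (λ a → ∑ (suc (m + s)) n λ b → ⟦ burn ℓ a (rest b) s (cnt 1 b + t) ⟧)
    + D n (suc (m + s)) * D m (n + t)
    ≡⟨ cong₂ _+_ (trans (∑-cong (n + t) m λ a → ∑-rest (m + s) n (λ k b → ⟦ burn ℓ a b s (k + t) ⟧))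
                 (trans (∑-Bin (n + t) m n _)
                        (Bin-cong n λ k r e → cong (λ M → ∑ M m λ a → ∑ (m + s) r λ b → ⟦ burn ℓ a b s (k + t) ⟧)
                                                   (total k r e))))
                 (trans (*-comm _ (D m (n + t))) (sym (trans (Bin-* n (D m (n + t)) _)
                   (cong (D m (n + t) *_) (Bin-D n (m + s)))))) ⟩
  Bin n (λ k r → burnt ℓ m r s (k + t)) + Bin n (λ k r → D m (n + t) * D r (m + s))
    ≡⟨ sym (Bin-+ n _ _) ⟩
  Bin n (λ k r → burnt ℓ m r s (k + t) + D m (n + t) * D r (m + s))
    ≡⟨ Bin-cong n step ⟩
  Bin n (λ k r → (n + t) ^ m * (m + s) ^ r)
    ≡⟨ trans (Bin-* n ((n + t) ^ m) _) (cong ((n + t) ^ m *_) (Bin-^ n (m + s))) ⟩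
  (n + t) ^ m * suc (m + s) ^ n
    ≡⟨ *-comm ((n + t) ^ m) _ ⟩
  suc (m + s) ^ n * (n + t) ^ m ∎
  where
  open ≡-Reasoning
  -- Catching fire does not change the number of vertices of Q still present, so the labels of P
  -- keep their range.
  total : ∀ k r → k + r ≡ n → n + t ≡ r + (k + t)
  total k r refl = trans (cong (_+ t) (+-comm k r)) (+-assoc r k t)
  step : ∀ k r → k + r ≡ n →
    burnt ℓ m r s (k + t) + D m (n + t) * D r (m + s) ≡ (n + t) ^ m * (m + s) ^ r
  step k r e = subst (λ z → burnt ℓ m r s (k + t) + D m z * D r (m + s) ≡ z ^ m * (m + s) ^ r)
    (sym (total k r e))
    (trans (cong (_+_ (burnt ℓ m r s (k + t))) (*-comm _ (D r (m + s))))
      (trans (burnt-count ℓ m r s (k + t) (subst (λ z → m + s + z ≤ ℓ) (total k r e) (s≤s⁻¹ h)))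
        (*-comm ((m + s) ^ r) _)))

-- Irreducible pairs as complete burnings.

start : ℕ → ℕ → ℕ → List ℕ → List ℕ → Bool
start ℓ zero    k       a b = false
start ℓ (suc j) zero    a b = false
start ℓ (suc j) (suc k) a b = burn ℓ a b j k

primeᵇ : ℕ → List ℕ → List ℕ → Bool
primeᵇ ℓ a b = start ℓ (cnt 1 a) (cnt 1 b) (rest a) (rest b)

Irreducible : ℕ → ℕ → List ℕ → List ℕ → Set
Irreducible p q a b = ∀ x y → x ≤ p → y ≤ q → ¬ (x ≡ 0 × y ≡ 0) → ¬ (x ≡ p × y ≡ q) →
  x < cnt y a ⊎ y < cnt x b

Irreducible-swap : ∀ {p q} a b → Irreducible p q a b → Irreducible q p b a
Irreducible-swap a b irr x y x≤ y≤ ≢₀ ≢₁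
  with irr y x y≤ x≤ (λ (e , e′) → ≢₀ (e′ , e)) (λ (e , e′) → ≢₁ (e′ , e))
... | inj₁ l = inj₂ l
... | inj₂ l = inj₁ l

-- Irreducibility at `(1 , 0)`: no entry of `a` is below 0, so the second alternative must hold.
irreducible⇒0<cnt : ∀ {p q} a b → 1 ≤ p → 1 ≤ q → Irreducible p q a b → 0 < cnt 1 b
irreducible⇒0<cnt a b 1≤p 1≤q irr
  with irr 1 0 1≤p z≤n (λ { (() , _) }) (λ (_ , e) → <⇒≢ 1≤q e)
... | inj₁ l rewrite cnt-zero a with () ← l
... | inj₂ l = l

private
  pred-length : ∀ {j} a → cnt 1 a ≡ suc j → suc (length (rest a) + j) ≡ length a
  pred-length {j} a e = trans (cong suc (+-comm _ j)) (trans (cong (_+ length (rest a)) (sym e)) (length-rest a))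

  cnt-suc′ : ∀ {j} t a → cnt 1 a ≡ suc j → cnt (suc t) a ≡ suc (cnt t (rest a) + j)
  cnt-suc′ {j} t a e = trans (cnt-suc t a) (trans (cong (_+ cnt t (rest a)) e) (cong suc (+-comm j _)))

-- Both lists contain a zero. Removing one zero from each shifts both coordinates by one, so that
-- irreducibility at `(suc x , suc y)` is `Good` at `(x , y)` with the remaining zeros alight from
-- the start.
irreducible⇒prime : ∀ ℓ a b → 1 ≤ length a → 1 ≤ length b → length a + length b ≤ ℓ →
  Irreducible (length a) (length b) a b → T (primeᵇ ℓ a b)
irreducible⇒prime ℓ a b 1≤p 1≤q h irr
  with cnt 1 a in ea | cnt 1 b in eb
     | irreducible⇒0<cnt b a 1≤q 1≤p (Irreducible-swap a b irr)
     | irreducible⇒0<cnt a b 1≤p 1≤q irr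
... | suc j | suc k | _ | _ = Good⇒burn ℓ (rest a) (rest b) j k fuel good
  where
  fuel : length (rest a) + j + (length (rest b) + k) ≤ ℓ
  fuel = ≤-trans (+-mono-≤ (≤-trans (n≤1+n _) (≤-reflexive (pred-length a ea)))
                           (≤-trans (n≤1+n _) (≤-reflexive (pred-length b eb)))) h
  good : Good (rest a) (rest b) j k
  good x y x≤ y≤ ≢
    with irr (suc x) (suc y) (subst (suc x ≤_) (pred-length a ea) (s≤s x≤))
             (subst (suc y ≤_) (pred-length b eb) (s≤s y≤)) (λ { (() , _) })
             (λ (e , e′) → ≢ (suc-injective (trans e (sym (pred-length a ea)))
                            , suc-injective (trans e′ (sym (pred-length b eb)))))
  ... | inj₁ l = inj₁ (s≤s⁻¹ (subst (suc x <_) (cnt-suc′ y a ea) l))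
  ... | inj₂ l = inj₂ (s≤s⁻¹ (subst (suc y <_) (cnt-suc′ x b eb) l))

prime⇒irreducible : ∀ ℓ a b → length a + length b ≤ ℓ → T (primeᵇ ℓ a b) →
  Irreducible (length a) (length b) a b
prime⇒irreducible ℓ a b h prime with cnt 1 a in ea | cnt 1 b in eb
... | suc j | suc k = irr
  where
  fuel : length (rest a) + j + (length (rest b) + k) ≤ ℓ
  fuel = ≤-trans (+-mono-≤ (≤-trans (n≤1+n _) (≤-reflexive (pred-length a ea)))
                           (≤-trans (n≤1+n _) (≤-reflexive (pred-length b eb)))) h
  irr : Irreducible (length a) (length b) a b
  irr zero    zero    x≤ y≤ ≢₀ ≢₁ = ⊥-elim (≢₀ (refl , refl))
  -- On the axes away from the origin the removed zeros supply the inequality.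
  irr zero    (suc y) x≤ y≤ ≢₀ ≢₁ = inj₁ (subst (0 <_) (sym (cnt-suc′ y a ea)) (s≤s z≤n))
  irr (suc x) zero    x≤ y≤ ≢₀ ≢₁ = inj₂ (subst (0 <_) (sym (cnt-suc′ x b eb)) (s≤s z≤n))
  irr (suc x) (suc y) x≤ y≤ ≢₀ ≢₁
    with burn⇒Good ℓ (rest a) (rest b) j k fuel prime x y
           (s≤s⁻¹ (subst (suc x ≤_) (sym (pred-length a ea)) x≤))
           (s≤s⁻¹ (subst (suc y ≤_) (sym (pred-length b eb)) y≤))
           (λ (e , e′) → ≢₁ (trans (cong suc e) (pred-length a ea) , trans (cong suc e′) (pred-length b eb)))
  ... | inj₁ l = inj₁ (subst (suc x <_) (sym (cnt-suc′ y a ea)) (s≤s l))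
  ... | inj₂ l = inj₂ (subst (suc y <_) (sym (cnt-suc′ x b eb)) (s≤s l))

-- The closed formula.

pos : ℕ → ℕ
pos zero    = 0
pos (suc _) = 1

-- The factor `pos k` removes just the term with `k = 0`, whose binomial coefficient is 1.
Bin-pos : ∀ n (h : ℕ → ℕ) → Bin n (λ k r → pos k * h r) + h n ≡ Bin n (λ k r → h r)
Bin-pos zero    h = refl
Bin-pos (suc n) h = begin
  (Bin n (λ k r → h r + 0) + Bin n (λ k r → pos k * h (suc r))) + h (suc n)
    ≡⟨ +-assoc (Bin n (λ k r → h r + 0)) _ _ ⟩
  Bin n (λ k r → h r + 0) + (Bin n (λ k r → pos k * h (suc r)) + h (suc n))
    ≡⟨ cong₂ _+_ (Bin-cong n λ k r _ → +-identityʳ (h r)) (Bin-pos n (h ∘ suc)) ⟩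
  Bin n (λ k r → h r) + Bin n (λ k r → h (suc r)) ∎
  where open ≡-Reasoning

Bin-Bin-* : ∀ m n (f g : ℕ → ℕ → ℕ) →
  Bin m (λ j i → Bin n λ k r → f j i * g k r) ≡ Bin m f * Bin n g
Bin-Bin-* m n f g = begin
  Bin m (λ j i → Bin n λ k r → f j i * g k r) ≡⟨ Bin-cong m (λ j i _ → trans (Bin-* n (f j i) g) (*-comm _ (Bin n g))) ⟩
  Bin m (λ j i → Bin n g * f j i)             ≡⟨ Bin-* m (Bin n g) f ⟩
  Bin n g * Bin m f                           ≡⟨ *-comm (Bin n g) _ ⟩
  Bin m f * Bin n g                           ∎
  where open ≡-Reasoning

-- p and q are kept opaque so that Bin p and Bin q do not unfold.
module _ (P Q p q : ℕ) (p≡ : p ≡ suc P) (q≡ : q ≡ suc Q) where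
  private
    -- `X` is `q ^ p` minus `Q ^ p`, the number of words for P that contain a zero, and `U` is `p`
    -- times the difference of `q ^ P` and `Q ^ P`. `Y` and `V` are the same with the parts
    -- exchanged.
    X = Bin p (λ j i → pos j * Q ^ i)
    Y = Bin q (λ k r → pos k * P ^ r)
    U = Bin p (λ j i → pos j * D i Q)
    V = Bin q (λ k r → pos k * D r P)

    started : ℕ → ℕ → ℕ → ℕ → ℕ
    started j i k r = ∑ Q i λ a → ∑ P r λ b → ⟦ start (p + q) j k a b ⟧

    -- After one zero is removed from each part, the totals `m + s` and `n + t` of `burnt-count` are
    -- `P` and `Q`. If a part has no zero, both sides vanish through `pos`.
    started-count : ∀ j i k r → j + i ≡ p → k + r ≡ q →
      started j i k r + pos j * D i Q * (pos k * D r P) ≡ pos j * Q ^ i * (pos k * P ^ r)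
    started-count zero    i k       r ej ek
      rewrite ∑-cong Q i (λ a → ∑-0 P r) | ∑-0 Q i = refl
    started-count (suc j) i zero    r ej ek
      rewrite ∑-cong Q i (λ a → ∑-0 P r) | ∑-0 Q i
            | *-zeroʳ (1 * D i Q) | *-zeroʳ (1 * Q ^ i) = refl
    started-count (suc j) i (suc k) r ej ek =
      trans (cong (_+_ (started (suc j) i (suc k) r)) (lem (D i Q) (D r P)))
        (trans (subst₂ (λ A B → (∑ B i λ a → ∑ A r λ b → ⟦ burn (p + q) a b j k ⟧) + D r A * D i B ≡ A ^ r * B ^ i)
                 eP eQ (burnt-count (p + q) i r j k
                   (subst₂ (λ x y → i + j + (r + k) ≤ x + y) (sym p≡) (sym q≡)
                     (≤-trans (≤-reflexive (cong₂ _+_ eP eQ)) (+-mono-≤ (n≤1+n P) (n≤1+n Q))))))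
          (sym (lem (Q ^ i) (P ^ r))))
      where
      lem : ∀ x y → 1 * x * (1 * y) ≡ y * x
      lem = solve-∀
      eP : i + j ≡ P
      eP = trans (+-comm i j) (suc-injective (trans ej p≡))
      eQ : r + k ≡ Q
      eQ = trans (+-comm r k) (suc-injective (trans ek q≡))

  -- Labels of P range below `suc Q`, which is `q`, and labels of Q below `p`; by
  -- `irreducible-bound` no irreducible pair is lost.
  primes : ℕ
  primes = ∑ (suc Q) p λ a → ∑ (suc P) q λ b → ⟦ primeᵇ (p + q) a b ⟧

  -- Both words are grouped by their zeros with `∑-rest`. In each group `started-count` applies, and
  -- its two products separate into a factor for P and a factor for Q.
  primes-Bin : primes + U * V ≡ X * Y
  primes-Bin = begin
    primes + U * V
      ≡⟨ cong₂ _+_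
           (trans (∑-cong (suc Q) p λ a → ∑-rest P q (λ k b → ⟦ start (p + q) (cnt 1 a) k (rest a) b ⟧))
           (trans (∑-rest Q p (λ j a → Bin q λ k r → ∑ P r λ b → ⟦ start (p + q) j k a b ⟧))
                  (Bin-cong p λ j i _ → ∑-Bin Q i q _)))
           (sym (Bin-Bin-* p q _ _)) ⟩
    Bin p (λ j i → Bin q λ k r → started j i k r)
      + Bin p (λ j i → Bin q λ k r → pos j * D i Q * (pos k * D r P))
      ≡⟨ sym (trans (Bin-cong p λ j i _ → Bin-+ q _ _) (Bin-+ p _ _)) ⟩
    Bin p (λ j i → Bin q λ k r → started j i k r + pos j * D i Q * (pos k * D r P))
      ≡⟨ Bin-cong p (λ j i ej → Bin-cong q λ k r ek → started-count j i k r ej ek) ⟩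
    Bin p (λ j i → Bin q λ k r → pos j * Q ^ i * (pos k * P ^ r))
      ≡⟨ Bin-Bin-* p q _ _ ⟩
    X * Y ∎
    where open ≡-Reasoning


private
  -- The four linear relations determine `X`, `Y`, `U`, `V`; in `X Y - U V` the terms with `σ τ`
  -- cancel. The intended values of `s`, `t`, `σ`, `τ` are `P ^ Q`, `Q ^ P`, `p ^ Q`, `q ^ P`.
  elimination : ∀ P Q C X Y U V s t σ τ → C ℤ.+ U ℤ.* V ≡ X ℤ.* Y →
    X ℤ.+ Q ℤ.* t ≡ (1ℤ ℤ.+ Q) ℤ.* τ → Y ℤ.+ P ℤ.* s ≡ (1ℤ ℤ.+ P) ℤ.* σ →
    U ℤ.+ (1ℤ ℤ.+ P) ℤ.* t ≡ (1ℤ ℤ.+ P) ℤ.* τ → V ℤ.+ (1ℤ ℤ.+ Q) ℤ.* s ≡ (1ℤ ℤ.+ Q) ℤ.* σ →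
    C ≡ (1ℤ ℤ.+ P) ℤ.* σ ℤ.* t ℤ.+ (1ℤ ℤ.+ Q) ℤ.* τ ℤ.* s ℤ.- (P ℤ.+ (1ℤ ℤ.+ Q)) ℤ.* s ℤ.* t
  elimination P Q C X Y U V s t σ τ c x y u v = begin
    C ≡⟨ move C (U ℤ.* V) c ⟩
    X ℤ.* Y ℤ.- U ℤ.* V
      ≡⟨ cong₂ ℤ._-_ (cong₂ ℤ._*_ (move X (Q ℤ.* t) x) (move Y (P ℤ.* s) y)) (cong₂ ℤ._*_ (move U _ u) (move V _ v)) ⟩
    ((1ℤ ℤ.+ Q) ℤ.* τ ℤ.- Q ℤ.* t) ℤ.* ((1ℤ ℤ.+ P) ℤ.* σ ℤ.- P ℤ.* s) ℤ.-
      ((1ℤ ℤ.+ P) ℤ.* τ ℤ.- (1ℤ ℤ.+ P) ℤ.* t) ℤ.* ((1ℤ ℤ.+ Q) ℤ.* σ ℤ.- (1ℤ ℤ.+ Q) ℤ.* s)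
      ≡⟨ ring P Q s t σ τ ⟩
    (1ℤ ℤ.+ P) ℤ.* σ ℤ.* t ℤ.+ (1ℤ ℤ.+ Q) ℤ.* τ ℤ.* s ℤ.- (P ℤ.+ (1ℤ ℤ.+ Q)) ℤ.* s ℤ.* t ∎
    where
    open ≡-Reasoning
    cancel : ∀ x y → x ≡ x ℤ.+ y ℤ.- y
    cancel = ℤ.solve-∀
    move : ∀ x y {z} → x ℤ.+ y ≡ z → x ≡ z ℤ.- y
    move x y e = trans (cancel x y) (cong (ℤ._- y) e)
    ring : ∀ P Q s t σ τ →
      ((1ℤ ℤ.+ Q) ℤ.* τ ℤ.- Q ℤ.* t) ℤ.* ((1ℤ ℤ.+ P) ℤ.* σ ℤ.- P ℤ.* s) ℤ.-
        ((1ℤ ℤ.+ P) ℤ.* τ ℤ.- (1ℤ ℤ.+ P) ℤ.* t) ℤ.* ((1ℤ ℤ.+ Q) ℤ.* σ ℤ.- (1ℤ ℤ.+ Q) ℤ.* s)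
      ≡ (1ℤ ℤ.+ P) ℤ.* σ ℤ.* t ℤ.+ (1ℤ ℤ.+ Q) ℤ.* τ ℤ.* s ℤ.- (P ℤ.+ (1ℤ ℤ.+ Q)) ℤ.* s ℤ.* t
    ring = ℤ.solve-∀

  pos-+* : ∀ x y z u v → x + y * z ≡ u * v → + x ℤ.+ + y ℤ.* + z ≡ + u ℤ.* + v
  pos-+* x y z u v e = trans (cong (λ w → + x ℤ.+ w) (sym (ℤ.pos-* y z))) (trans (cong +_ e) (ℤ.pos-* u v))

primes-count : ∀ P Q → let p = suc P; q = suc Q in
  + primes P Q p q refl refl ≡
    + (p ^ q * Q ^ P) ℤ.+ + (q ^ p * P ^ Q) ℤ.- + ((P + q) * P ^ Q * Q ^ P)
primes-count P Q = trans
  (elimination (+ P) (+ Q) (+ C) (+ X) (+ Y) (+ U) (+ V) (+ (P ^ Q)) (+ (Q ^ P)) (+ (p ^ Q)) (+ (q ^ P))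
    (pos-+* C U V X Y (primes-Bin P Q p q refl refl))
    (pos-+* X Q _ q _ (trans (Bin-pos p (Q ^_)) (Bin-^ p Q)))
    (pos-+* Y P _ p _ (trans (Bin-pos q (P ^_)) (Bin-^ q P)))
    (pos-+* U p _ p _ (trans (cong (_+_ U) (sym (D-suc P Q)))
      (trans (Bin-pos p (λ i → D i Q)) (trans (Bin-D p Q) (D-suc P q)))))
    (pos-+* V q _ q _ (trans (cong (_+_ V) (sym (D-suc Q P)))
      (trans (Bin-pos q (λ r → D r P)) (trans (Bin-D q P) (D-suc Q p))))))
  (cong₂ ℤ._-_ (cong₂ ℤ._+_ (pos-** p (p ^ Q) (Q ^ P)) (pos-** q (q ^ P) (P ^ Q)))
    (pos-** (P + q) (P ^ Q) (Q ^ P)))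
  where
  p = suc P
  q = suc Q
  C = primes P Q p q refl refl
  X = Bin p (λ j i → pos j * Q ^ i)
  Y = Bin q (λ k r → pos k * P ^ r)
  U = Bin p (λ j i → pos j * D i Q)
  V = Bin q (λ k r → pos k * D r P)
  pos-** : ∀ x y z → + x ℤ.* + y ℤ.* + z ≡ + (x * y * z)
  pos-** x y z = trans (cong (ℤ._* + z) (sym (ℤ.pos-* x y))) (sym (ℤ.pos-* (x * y) z))

-- Cardinalities of decidable subsets of `Fin n`.

# : ∀ {n} → (Fin n → Bool) → ℕ
# g = Vec.sum (tabulate λ i → ⟦ g i ⟧)

#-cong : ∀ {n} {g h : Fin n → Bool} → (∀ i → g i ≡ h i) → # g ≡ # h
#-cong e = cong Vec.sum (tabulate-cong (cong ⟦_⟧ ∘ e))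

#≤n : ∀ {n} (g : Fin n → Bool) → # g ≤ n
#≤n {zero}  g = z≤n
#≤n {suc n} g with g zero
... | true  = s≤s (#≤n (g ∘ suc))
... | false = m≤n⇒m≤1+n (#≤n (g ∘ suc))

#-mono : ∀ {n} (g h : Fin n → Bool) → (∀ i → g i ≡ true → h i ≡ true) → # g ≤ # h
#-mono {zero}  g h g⇒h = z≤n
#-mono {suc n} g h g⇒h with g zero in e | h zero in e′
... | true  | true  = s≤s (#-mono (g ∘ suc) (h ∘ suc) (g⇒h ∘ suc))
... | true  | false with () ← trans (sym (g⇒h zero e)) e′
... | false | true  = m≤n⇒m≤1+n (#-mono (g ∘ suc) (h ∘ suc) (g⇒h ∘ suc))
... | false | false = #-mono (g ∘ suc) (h ∘ suc) (g⇒h ∘ suc)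

#-mono-< : ∀ {n} (g h : Fin n → Bool) → (∀ i → g i ≡ true → h i ≡ true) →
  ∀ i → g i ≡ false → h i ≡ true → # g < # h
#-mono-< g h g⇒h zero eg eh rewrite eg | eh = s≤s (#-mono (g ∘ suc) (h ∘ suc) (g⇒h ∘ suc))
#-mono-< g h g⇒h (suc i) eg eh with g zero in e | h zero in e′
... | true  | true  = s≤s (#-mono-< (g ∘ suc) (h ∘ suc) (g⇒h ∘ suc) i eg eh)
... | true  | false with () ← trans (sym (g⇒h zero e)) e′
... | false | true  = m≤n⇒m≤1+n (#-mono-< (g ∘ suc) (h ∘ suc) (g⇒h ∘ suc) i eg eh)
... | false | false = #-mono-< (g ∘ suc) (h ∘ suc) (g⇒h ∘ suc) i eg eh

#-none : ∀ n → # {n} (λ _ → false) ≡ 0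
#-none zero    = refl
#-none (suc n) = #-none n

#-all : ∀ {n} → # {n} (λ _ → true) ≡ n
#-all {zero}  = refl
#-all {suc n} = cong suc #-all

true⇒0<# : ∀ {n} (g : Fin n → Bool) i → g i ≡ true → 0 < # g
true⇒0<# {n} g i e = subst (_< # g) (#-none n) (#-mono-< (λ _ → false) g (λ _ ()) i refl e)

false⇒#<n : ∀ {n} (g : Fin n → Bool) i → g i ≡ false → # g < n
false⇒#<n g i e = subst (# g <_) #-all (#-mono-< g (λ _ → true) (λ _ _ → refl) i e refl)

pigeonhole : ∀ {n} (g h : Fin n → Bool) → # g < # h → ∃ λ i → h i ≡ true × g i ≡ false
pigeonhole {suc n} g h l with g zero in e | h zero in e′
... | false | true  = zero , e′ , e
... | true  | true  with i , p ← pigeonhole (g ∘ suc) (h ∘ suc) (s≤s⁻¹ l) = suc i , p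
... | true  | false with i , p ← pigeonhole (g ∘ suc) (h ∘ suc) (≤-trans (n≤1+n _) l) = suc i , p
... | false | false with i , p ← pigeonhole (g ∘ suc) (h ∘ suc) l = suc i , p

0<#⇒∃true : ∀ {n} (g : Fin n → Bool) → 0 < # g → ∃ λ i → g i ≡ true
0<#⇒∃true {n} g l with i , e , _ ← pigeonhole (λ _ → false) g (subst (_< # g) (sym (#-none n)) l) = i , e

#<n⇒∃false : ∀ {n} (g : Fin n → Bool) → # g < n → ∃ λ i → g i ≡ false
#<n⇒∃false g l with i , _ , e ← pigeonhole g (λ _ → true) (subst (# g <_) (sym #-all) l) = i , e

-- This breaks ties: if the vertices with label below a threshold are at most `x` and those with
-- label up to the threshold at least `x`, then some set in between has exactly `x` elements.
interpolate : ∀ {n} (g h : Fin n → Bool) x → (∀ i → g i ≡ true → h i ≡ true) → # g ≤ x → x ≤ # h →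
  ∃ λ (χ : Fin n → Bool) → # χ ≡ x × (∀ i → g i ≡ true → χ i ≡ true) × (∀ i → χ i ≡ true → h i ≡ true)
interpolate g h x g⇒h g≤x x≤h with # g ≟ x
... | yes e = g , e , (λ _ e → e) , g⇒h
interpolate {zero} g h x g⇒h g≤x x≤h | no ≢ = contradiction (≤-antisym g≤x x≤h) ≢
interpolate {suc n} g h x g⇒h g≤x x≤h | no ≢ with g zero in eg | h zero in eh
... | true | false with () ← trans (sym (g⇒h zero eg)) eh
interpolate {suc n} g h x g⇒h g≤x x≤h | no ≢ | false | false
  with χ , e , g⇒χ , χ⇒h ← interpolate (g ∘ suc) (h ∘ suc) x (g⇒h ∘ suc) g≤x x≤h =
  (λ { zero → false ; (suc i) → χ i }) , e
  , (λ { zero e → trans (sym eg) e ; (suc i) → g⇒χ i })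
  , (λ { zero () ; (suc i) → χ⇒h i })
-- An optional element is taken greedily, which is possible because `# g` is still strictly below
-- the target.
interpolate {suc n} g h (suc x) g⇒h g≤x x≤h | no ≢ | false | true
  with χ , e , g⇒χ , χ⇒h ← interpolate (g ∘ suc) (h ∘ suc) x (g⇒h ∘ suc) (s≤s⁻¹ (≤∧≢⇒< g≤x ≢)) (s≤s⁻¹ x≤h) =
  (λ { zero → true ; (suc i) → χ i }) , cong suc e
  , (λ { zero _ → refl ; (suc i) → g⇒χ i })
  , (λ { zero _ → eh ; (suc i) → χ⇒h i })
interpolate {suc n} g h zero g⇒h g≤x x≤h | no ≢ | false | true = contradiction (≤-antisym g≤x z≤n) ≢
interpolate {suc n} g h (suc x) g⇒h g≤x x≤h | no ≢ | true | true
  with χ , e , g⇒χ , χ⇒h ← interpolate (g ∘ suc) (h ∘ suc) x (g⇒h ∘ suc) (s≤s⁻¹ g≤x) (s≤s⁻¹ x≤h) =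
  (λ { zero → true ; (suc i) → χ i }) , cong suc e
  , (λ { zero _ → refl ; (suc i) → g⇒χ i })
  , (λ { zero _ → eh ; (suc i) → χ⇒h i })

sum-tabulate-+ : ∀ {n} (g h : Fin n → ℕ) →
  Vec.sum (tabulate λ i → g i + h i) ≡ Vec.sum (tabulate g) + Vec.sum (tabulate h)
sum-tabulate-+ {zero}  g h = refl
sum-tabulate-+ {suc n} g h = trans (cong (_+_ (g zero + h zero)) (sum-tabulate-+ (g ∘ suc) (h ∘ suc)))
  (+-interchange (g zero) (h zero) _ _)

sum-tabulate-split : ∀ p q (g : Fin (p + q) → ℕ) →
  Vec.sum (tabulate g) ≡ Vec.sum (tabulate λ i → g (i ↑ˡ q)) + Vec.sum (tabulate λ j → g (p ↑ʳ j))
sum-tabulate-split zero    q g = refl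
sum-tabulate-split (suc p) q g =
  trans (cong (_+_ (g zero)) (sum-tabulate-split p q (g ∘ suc))) (sym (+-assoc (g zero) _ _))

sum-tabulate-0 : ∀ {n} {g : Fin n → ℕ} → (∀ i → g i ≡ 0) → Vec.sum (tabulate g) ≡ 0
sum-tabulate-0 {zero}  e = refl
sum-tabulate-0 {suc n} e = cong₂ _+_ (e zero) (sum-tabulate-0 (e ∘ suc))

↑-elim : ∀ p q (R : Fin (p + q) → Set) → (∀ i → R (i ↑ˡ q)) → (∀ j → R (p ↑ʳ j)) → ∀ v → R v
↑-elim p q R left right v with splitAt p v in e
... | inj₁ i = subst R (splitAt⁻¹-↑ˡ e) (left i)
... | inj₂ j = subst R (splitAt⁻¹-↑ʳ {p} {q} e) (right j)

<⇒<ᵇ≡true : ∀ {m n} → m < n → (m <ᵇ n) ≡ true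
<⇒<ᵇ≡true {m} {n} l with m <ᵇ n | <⇒<ᵇ l
... | true | _ = refl

<ᵇ≡true⇒< : ∀ {m n} → (m <ᵇ n) ≡ true → m < n
<ᵇ≡true⇒< {m} {n} e = <ᵇ⇒< m n (subst T (sym e) _)

≤⇒<ᵇ≡false : ∀ {m n} → n ≤ m → (m <ᵇ n) ≡ false
≤⇒<ᵇ≡false {m} {n} l with m <ᵇ n in e
... | true  = contradiction l (<⇒≱ (<ᵇ≡true⇒< e))
... | false = refl

<ᵇ≡false⇒≤ : ∀ {m n} → (m <ᵇ n) ≡ false → n ≤ m
<ᵇ≡false⇒≤ {m} {n} e = ≮⇒≥ λ l → case-⊥ (trans (sym (<⇒<ᵇ≡true l)) e)
  where
  case-⊥ : true ≡ false → ⊥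
  case-⊥ ()

not-true : ∀ {c} → not c ≡ true → c ≡ false
not-true {false} _ = refl

not-false : ∀ {c} → not c ≡ false → c ≡ true
not-false {true} _ = refl

contra : ∀ {c d} → (c ≡ true → d ≡ true) → d ≡ false → c ≡ false
contra {false} c⇒d e = refl
contra {true}  c⇒d e with () ← trans (sym (c⇒d refl)) e

∧-true : ∀ {c d} → c ∧ d ≡ true → c ≡ true
∧-true {true} _ = refl

#≡0⇒false : ∀ {n} (g : Fin n → Bool) → # g ≡ 0 → ∀ i → g i ≡ false
#≡0⇒false g e i with g i in eg
... | false = refl
... | true  = contradiction (sym e) (<⇒≢ (true⇒0<# g i eg))

-- Prime parking functions of the complete tripartite graph.

deg : ∀ p q → (Fin (p + q) → Bool) → Fin (p + q) → ℕ
deg p q χ v = Vec.sum (tabulate λ w → if χ w then Kmult p q v w else 0)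

inP-↑ˡ : ∀ p q i → inP p q (i ↑ˡ q) ≡ true
inP-↑ˡ p q i rewrite toℕ-↑ˡ i q = <⇒<ᵇ≡true (toℕ<n i)

inP-↑ʳ : ∀ p q j → inP p q (p ↑ʳ j) ≡ false
inP-↑ʳ p q j rewrite toℕ-↑ʳ p j = ≤⇒<ᵇ≡false (m≤m+n p (toℕ j))

private
  if-0 : ∀ c {k} → k ≡ 0 → (if c then k else 0) ≡ 0
  if-0 true  e = e
  if-0 false e = refl

deg-↑ˡ : ∀ p q χ i → deg p q χ (i ↑ˡ q) ≡ # λ j → χ (p ↑ʳ j)
deg-↑ˡ p q χ i = trans (sum-tabulate-split p q _) (cong₂ _+_
  (sum-tabulate-0 λ i′ → if-0 (χ (i′ ↑ˡ q)) (same i′))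
  (cong Vec.sum (tabulate-cong λ j → cong (λ k → if χ (p ↑ʳ j) then k else 0) (other j))))
  where
  same : ∀ i′ → Kmult p q (i ↑ˡ q) (i′ ↑ˡ q) ≡ 0
  same i′ rewrite inP-↑ˡ p q i | inP-↑ˡ p q i′ = refl
  other : ∀ j → Kmult p q (i ↑ˡ q) (p ↑ʳ j) ≡ 1
  other j rewrite inP-↑ˡ p q i | inP-↑ʳ p q j = refl

deg-↑ʳ : ∀ p q χ j → deg p q χ (p ↑ʳ j) ≡ # λ i → χ (i ↑ˡ q)
deg-↑ʳ p q χ j = trans (sum-tabulate-split p q _) (trans (cong₂ _+_
  (cong Vec.sum (tabulate-cong λ i → cong (λ k → if χ (i ↑ˡ q) then k else 0) (other i)))
  (sum-tabulate-0 λ j′ → if-0 (χ (p ↑ʳ j′)) (same j′)))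
  (+-identityʳ _))
  where
  same : ∀ j′ → Kmult p q (p ↑ʳ j) (p ↑ʳ j′) ≡ 0
  same j′ rewrite inP-↑ʳ p q j | inP-↑ʳ p q j′ = refl
  other : ∀ i → Kmult p q (p ↑ʳ j) (i ↑ˡ q) ≡ 1
  other i rewrite inP-↑ˡ p q i | inP-↑ʳ p q j = refl

decrement : ∀ {n} → Vec ℕ n → List ℕ
decrement f = map (λ x → x ∸ 1) (toList f)

cnt-decrement : ∀ {n} t (f : Vec ℕ n) → cnt t (decrement f) ≡ # λ i → lookup f i ∸ 1 <ᵇ t
cnt-decrement t []      = refl
cnt-decrement t (x ∷ f) = cong (_+_ ⟦ x ∸ 1 <ᵇ t ⟧) (cnt-decrement t f)

∈⇒true : ∀ {n} {A : Subset n} {v} → v ∈ₛ A → lookup A v ≡ true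
∈⇒true = []=⇒lookup

true⇒∈ : ∀ {n} {A : Subset n} {v} → lookup A v ≡ true → v ∈ₛ A
true⇒∈ {A = A} {v} = lookup⇒[]= v A

∈∁⇒false : ∀ {n} {A : Subset n} {v} → v ∈ₛ ∁ A → lookup A v ≡ false
∈∁⇒false {A = A} {v} v∈ with lookup A v | trans (sym (lookup-map v not A)) (∈⇒true v∈)
... | false | _ = refl

false⇒∈∁ : ∀ {n} {A : Subset n} {v} → lookup A v ≡ false → v ∈ₛ ∁ A
false⇒∈∁ {A = A} {v} e = true⇒∈ (trans (lookup-map v not A) (cong not e))

module Decomposition {p q : ℕ} (fp : Vec ℕ p) (fq : Vec ℕ q) where
  open SinkGraph (Kmult p q) (Ksink p q)

  private
    f : Fin (p + q) → ℕ
    f = pairToFun fp fq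

    a : Fin p → ℕ
    a i = lookup fp i ∸ 1

    b : Fin q → ℕ
    b j = lookup fq j ∸ 1

    cP cQ : ℕ → ℕ
    cP t = # λ i → a i <ᵇ t
    cQ t = # λ j → b j <ᵇ t

    f≥1⇒a : (∀ v → 1 ≤ f v) → ∀ i → f (i ↑ˡ q) ≡ suc (a i)
    f≥1⇒a f≥1 i = trans (sym (m+[n∸m]≡n (f≥1 (i ↑ˡ q))))
      (cong (λ z → suc (z ∸ 1)) (lookup-++ˡ fp fq i))

    f≥1⇒b : (∀ v → 1 ≤ f v) → ∀ j → f (p ↑ʳ j) ≡ suc (b j)
    f≥1⇒b f≥1 j = trans (sym (m+[n∸m]≡n (f≥1 (p ↑ʳ j))))
      (cong (λ z → suc (z ∸ 1)) (lookup-++ʳ fp fq j))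

    left : Subset (p + q) → Fin p → Bool
    left A i = lookup A (i ↑ˡ q)

    right : Subset (p + q) → Fin q → Bool
    right A j = lookup A (p ↑ʳ j)

    _⊍_ : (Fin p → Bool) → (Fin q → Bool) → Subset (p + q)
    s₁ ⊍ s₂ = tabulate s₁ Vec.++ tabulate s₂

    left-⊍ : ∀ s₁ s₂ i → left (s₁ ⊍ s₂) i ≡ s₁ i
    left-⊍ s₁ s₂ i = trans (lookup-++ˡ (tabulate s₁) (tabulate s₂) i) (lookup∘tabulate s₁ i)

    right-⊍ : ∀ s₁ s₂ j → right (s₁ ⊍ s₂) j ≡ s₂ j
    right-⊍ s₁ s₂ j = trans (lookup-++ʳ (tabulate s₁) (tabulate s₂) j) (lookup∘tabulate s₂ j)

    deg-cong : ∀ {χ χ′} v → (∀ w → χ w ≡ χ′ w) → deg p q χ v ≡ deg p q χ′ v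
    deg-cong v e = cong Vec.sum (tabulate-cong λ w → cong (λ c → if c then Kmult p q v w else 0) (e w))

    degOutside-⊤ : ∀ S v → degOutside ⊤ S v ≡ suc (deg p q (λ w → not (lookup S w)) v)
    degOutside-⊤ S v = cong suc (deg-cong v λ w → cong (_∧ not (lookup S w)) (lookup-replicate w true))

    degOutside-P : ∀ A S i → degOutside A S (i ↑ˡ q) ≡ suc (# λ j → right A j ∧ not (right S j))
    degOutside-P A S i = cong suc (deg-↑ˡ p q (λ w → lookup A w ∧ not (lookup S w)) i)

    degOutside-Q : ∀ A S j → degOutside A S (p ↑ʳ j) ≡ suc (# λ i → left A i ∧ not (left S i))
    degOutside-Q A S j = cong suc (deg-↑ʳ p q (λ w → lookup A w ∧ not (lookup S w)) j)

    degOutside-⊤-P : ∀ S i → degOutside ⊤ S (i ↑ˡ q) ≡ suc (# (not ∘ right S))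
    degOutside-⊤-P S i = trans (degOutside-⊤ S _) (cong suc (deg-↑ˡ p q (not ∘ lookup S) i))

    degOutside-⊤-Q : ∀ S j → degOutside ⊤ S (p ↑ʳ j) ≡ suc (# (not ∘ left S))
    degOutside-⊤-Q S j = trans (degOutside-⊤ S _) (cong suc (deg-↑ʳ p q (not ∘ lookup S) j))

  module _ (pf : IsPF f) where
    private
      f≥1 : ∀ v → 1 ≤ f v
      f≥1 v = proj₁ pf v ∈⊤

      f≡a : ∀ i → f (i ↑ˡ q) ≡ suc (a i)
      f≡a = f≥1⇒a f≥1

      f≡b : ∀ j → f (p ↑ʳ j) ≡ suc (b j)
      f≡b = f≥1⇒b f≥1

    -- The parking condition is applied to the set of vertices of P with label at least `u` and of Q
    -- with label at least `w`. The vertex it provides has a label between its threshold and the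
    -- number of vertices of the other part outside the set.
    parking-thresholds : ∀ u w → cP u < p ⊎ cQ w < q → u ≤ cQ w ⊎ w ≤ cP u
    parking-thresholds u w l =
      let v , v∈S , fv≤ = proj₂ pf S (λ _ → ∈⊤) (nonempty l) in
      ↑-elim p q (λ v → v ∈ₛ S → f v ≤ degOutside ⊤ S v → u ≤ cQ w ⊎ w ≤ cP u) onP onQ v v∈S fv≤
      where
      s₁ : Fin p → Bool
      s₁ i = not (a i <ᵇ u)
      s₂ : Fin q → Bool
      s₂ j = not (b j <ᵇ w)
      S = s₁ ⊍ s₂
      nonempty : cP u < p ⊎ cQ w < q → Nonempty S
      nonempty (inj₁ l) with i , e ← #<n⇒∃false _ l = i ↑ˡ q , true⇒∈ (trans (left-⊍ s₁ s₂ i) (cong not e))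
      nonempty (inj₂ l) with j , e ← #<n⇒∃false _ l = p ↑ʳ j , true⇒∈ (trans (right-⊍ s₁ s₂ j) (cong not e))
      onP : ∀ i → (i ↑ˡ q) ∈ₛ S → f (i ↑ˡ q) ≤ degOutside ⊤ S (i ↑ˡ q) → u ≤ cQ w ⊎ w ≤ cP u
      onP i i∈ le = inj₁ (≤-trans
        (<ᵇ≡false⇒≤ (not-true (trans (sym (left-⊍ s₁ s₂ i)) (∈⇒true i∈))))
        (s≤s⁻¹ (subst₂ _≤_ (f≡a i) eq le)))
        where
        eq : degOutside ⊤ S (i ↑ˡ q) ≡ suc (cQ w)
        eq = trans (degOutside-⊤-P S i) (cong suc
          (#-cong λ j → trans (cong not (right-⊍ s₁ s₂ j)) (not-involutive _)))
      onQ : ∀ j → (p ↑ʳ j) ∈ₛ S → f (p ↑ʳ j) ≤ degOutside ⊤ S (p ↑ʳ j) → u ≤ cQ w ⊎ w ≤ cP u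
      onQ j j∈ le = inj₂ (≤-trans
        (<ᵇ≡false⇒≤ (not-true (trans (sym (right-⊍ s₁ s₂ j)) (∈⇒true j∈))))
        (s≤s⁻¹ (subst₂ _≤_ (f≡b j) eq le)))
        where
        eq : degOutside ⊤ S (p ↑ʳ j) ≡ suc (cP u)
        eq = trans (degOutside-⊤-Q S j) (cong suc
          (#-cong λ i → trans (cong not (left-⊍ s₁ s₂ i)) (not-involutive _)))

    -- The hypotheses say that `χ₁` and `χ₂` select vertices with smallest labels, the threshold in
    -- each part being the number selected in the other. Vertices whose label equals the threshold
    -- may fall on either side.
    module _ (χ₁ : Fin p → Bool) (χ₂ : Fin q → Bool)
      (a<⇒χ₁ : ∀ i → (a i <ᵇ # χ₂) ≡ true → χ₁ i ≡ true)
      (χ₁⇒a≤ : ∀ i → χ₁ i ≡ true → (a i <ᵇ suc (# χ₂)) ≡ true)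
      (b<⇒χ₂ : ∀ j → (b j <ᵇ # χ₁) ≡ true → χ₂ j ≡ true)
      (χ₂⇒b≤ : ∀ j → χ₂ j ≡ true → (b j <ᵇ suc (# χ₁)) ≡ true) where
      private
        A = χ₁ ⊍ χ₂

        right-A : # (right A) ≡ # χ₂
        right-A = #-cong (right-⊍ χ₁ χ₂)

        left-A : # (left A) ≡ # χ₁
        left-A = #-cong (left-⊍ χ₁ χ₂)

        ∉A⇒≤a : ∀ i → left A i ≡ false → # (right A) ≤ a i
        ∉A⇒≤a i e = subst (_≤ a i) (sym right-A)
          (<ᵇ≡false⇒≤ (contra (a<⇒χ₁ i) (trans (sym (left-⊍ χ₁ χ₂ i)) e)))

        ∉A⇒≤b : ∀ j → right A j ≡ false → # (left A) ≤ b j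
        ∉A⇒≤b j e = subst (_≤ b j) (sym left-A)
          (<ᵇ≡false⇒≤ (contra (b<⇒χ₂ j) (trans (sym (right-⊍ χ₁ χ₂ j)) e)))

        ∈A⇒a≤ : ∀ i → left A i ≡ true → a i ≤ # (right A)
        ∈A⇒a≤ i e = subst (a i ≤_) (sym right-A)
          (s≤s⁻¹ (<ᵇ≡true⇒< (χ₁⇒a≤ i (trans (sym (left-⊍ χ₁ χ₂ i)) e))))

        ∈A⇒b≤ : ∀ j → right A j ≡ true → b j ≤ # (left A)
        ∈A⇒b≤ j e = subst (b j ≤_) (sym left-A)
          (s≤s⁻¹ (<ᵇ≡true⇒< (χ₂⇒b≤ j (trans (sym (right-⊍ χ₁ χ₂ j)) e))))

        -- Parking of `f` is applied to `S` together with all vertices outside `A`. If the vertex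
        -- found lies outside `A`, its large label forces `S` to avoid the other part, and then
        -- every vertex of `S` has a label small enough.
        lower : IsPFOn A f
        lower = (λ v _ → f≥1 v) , park
          where
          park : ∀ S → S ⊆ₛ A → Nonempty S → ∃ λ v → v ∈ₛ S × f v ≤ degOutside A S v
          park S S⊆A (v₀ , v₀∈S) =
            let v , v∈S′ , fv≤ = proj₂ pf S′ (λ _ → ∈⊤) nonempty in
            ↑-elim p q R onP onQ v (inS′ v v∈S′) (subst (f v ≤_) (eq v) fv≤)
            where
            -- The complement of `S′` is `A` without `S`, which makes the two outside degrees agree.
            s′ : Fin (p + q) → Bool
            s′ w = not (lookup A w ∧ not (lookup S w))
            S′ = tabulate s′
            nonempty : Nonempty S′
            nonempty = v₀ , true⇒∈ (trans (lookup∘tabulate s′ v₀)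
              (cong₂ (λ x y → not (x ∧ not y)) (∈⇒true (S⊆A v₀∈S)) (∈⇒true v₀∈S)))
            R : Fin (p + q) → Set
            R v = not (lookup A v ∧ not (lookup S v)) ≡ true → f v ≤ degOutside A S v →
              ∃ λ v → v ∈ₛ S × f v ≤ degOutside A S v
            inS′ : ∀ v → v ∈ₛ S′ → s′ v ≡ true
            inS′ v v∈S′ = trans (sym (lookup∘tabulate s′ v)) (∈⇒true v∈S′)
            eq : ∀ v → degOutside ⊤ S′ v ≡ degOutside A S v
            eq v = trans (degOutside-⊤ S′ v) (cong suc (deg-cong v λ w →
              trans (cong not (lookup∘tabulate s′ w)) (not-involutive _)))
            outside : Bool → Bool → Bool
            outside x y = x ∧ not y
            onP : ∀ i → R (i ↑ˡ q)
            onP i e le with lookup A (i ↑ˡ q) in eA | lookup S (i ↑ˡ q) in eS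
            ... | true  | true  = i ↑ˡ q , true⇒∈ eS , le
            -- The vertex is outside `A`, so its label is at least `# (right A)`; as it is also at
            -- most `r`, no vertex of Q in `A` can belong to `S`.
            ... | false | _     = ↑-elim p q (λ v₀ → v₀ ∈ₛ S → _) onP₀ onQ₀ v₀ v₀∈S
              where
              r = # λ j → outside (right A j) (right S j)
              A≤r : # (right A) ≤ r
              A≤r = ≤-trans (∉A⇒≤a i eA) (s≤s⁻¹ (subst₂ _≤_ (f≡a i) (degOutside-P A S i) le))
              onP₀ : ∀ i₀ → (i₀ ↑ˡ q) ∈ₛ S → ∃ λ v → v ∈ₛ S × f v ≤ degOutside A S v
              onP₀ i₀ i₀∈ = i₀ ↑ˡ q , i₀∈ , subst₂ _≤_ (sym (f≡a i₀)) (sym (degOutside-P A S i₀))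
                (s≤s (≤-trans (∈A⇒a≤ i₀ (∈⇒true (S⊆A i₀∈))) A≤r))
              onQ₀ : ∀ j₀ → (p ↑ʳ j₀) ∈ₛ S → ∃ λ v → v ∈ₛ S × f v ≤ degOutside A S v
              onQ₀ j₀ j₀∈ = contradiction A≤r (<⇒≱ (#-mono-< (λ j → outside (right A j) (right S j)) (right A) (λ j → ∧-true) j₀
                (cong₂ outside (∈⇒true (S⊆A j₀∈)) (∈⇒true j₀∈)) (∈⇒true (S⊆A j₀∈))))
            onQ : ∀ j → R (p ↑ʳ j)
            onQ j e le with lookup A (p ↑ʳ j) in eA | lookup S (p ↑ʳ j) in eS
            ... | true  | true  = p ↑ʳ j , true⇒∈ eS , le
            ... | false | _     = ↑-elim p q (λ v₀ → v₀ ∈ₛ S → _) onP₀ onQ₀ v₀ v₀∈S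
              where
              r = # λ i → outside (left A i) (left S i)
              A≤r : # (left A) ≤ r
              A≤r = ≤-trans (∉A⇒≤b j eA) (s≤s⁻¹ (subst₂ _≤_ (f≡b j) (degOutside-Q A S j) le))
              onQ₀ : ∀ j₀ → (p ↑ʳ j₀) ∈ₛ S → ∃ λ v → v ∈ₛ S × f v ≤ degOutside A S v
              onQ₀ j₀ j₀∈ = p ↑ʳ j₀ , j₀∈ , subst₂ _≤_ (sym (f≡b j₀)) (sym (degOutside-Q A S j₀))
                (s≤s (≤-trans (∈A⇒b≤ j₀ (∈⇒true (S⊆A j₀∈))) A≤r))
              onP₀ : ∀ i₀ → (i₀ ↑ˡ q) ∈ₛ S → ∃ λ v → v ∈ₛ S × f v ≤ degOutside A S v
              onP₀ i₀ i₀∈ = contradiction A≤r (<⇒≱ (#-mono-< (λ i → outside (left A i) (left S i)) (left A) (λ i → ∧-true) i₀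
                (cong₂ outside (∈⇒true (S⊆A i₀∈)) (∈⇒true i₀∈)) (∈⇒true (S⊆A i₀∈))))

        -- Labels outside `A` are at least the number of neighbours in `A`, so `f` stays positive
        -- after the subtraction. For parking the same set `S` is used: it is disjoint from `A`, so
        -- its outside degree splits into the subtracted part and the degree within `∁ A`.
        upper : IsPFOn (∁ A) (λ v → f v ∸ degInto A v)
        upper = positive , park
          where
          positive : ∀ v → v ∈ₛ ∁ A → 1 ≤ f v ∸ degInto A v
          positive = ↑-elim p q _
            (λ i i∈ → m<n⇒0<n∸m (subst₂ _<_ (sym (deg-↑ˡ p q (lookup A) i)) (sym (f≡a i)) (s≤s (∉A⇒≤a i (∈∁⇒false i∈)))))
            (λ j j∈ → m<n⇒0<n∸m (subst₂ _<_ (sym (deg-↑ʳ p q (lookup A) j)) (sym (f≡b j)) (s≤s (∉A⇒≤b j (∈∁⇒false j∈)))))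
          park : ∀ S → S ⊆ₛ ∁ A → Nonempty S → ∃ λ v → v ∈ₛ S × f v ∸ degInto A v ≤ degOutside (∁ A) S v
          park S S⊆∁A ne =
            let v , v∈S , fv≤ = proj₂ pf S (λ _ → ∈⊤) ne in
            v , v∈S , m≤n+o⇒m∸n≤o (f v) (degInto A v) (subst (f v ≤_) (degOutside-+ v) fv≤)
            where
            split : ∀ v w → (if not (lookup S w) then Kmult p q v w else 0) ≡
              (if lookup A w then Kmult p q v w else 0) + (if lookup (∁ A) w ∧ not (lookup S w) then Kmult p q v w else 0)
            split v w rewrite lookup-map w not A with lookup A w in eA | lookup S w in eS
            ... | false | _     = refl
            ... | true  | false = sym (+-identityʳ _)
            ... | true  | true  with () ← trans (sym eA) (∈∁⇒false (S⊆∁A (true⇒∈ eS)))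
            degOutside-+ : ∀ v → degOutside ⊤ S v ≡ degInto A v + degOutside (∁ A) S v
            degOutside-+ v = trans (degOutside-⊤ S v) (trans
              (cong suc (trans (cong Vec.sum (tabulate-cong (split v))) (sum-tabulate-+ {p + q} _ _)))
              (sym (+-suc (degInto A v) _)))

      decomposable : Decomposable f A
      decomposable = lower , upper

  -- At a violating point parking shows that enough vertices have labels up to the threshold.
  -- Interpolation then yields exactly `x` vertices of P and `y` of Q, and these form the first
  -- block of a decomposition.
  IsPrimePF⇒Irreducible : IsPrimePF f → Irreducible p q (decrement fp) (decrement fq)
  IsPrimePF⇒Irreducible (pf , prime) x y x≤p y≤q ≢₀ ≢₁
    rewrite cnt-decrement y fp | cnt-decrement x fq with x <? cP y | y <? cQ x
  ... | yes l | _     = inj₁ l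
  ... | no _  | yes l = inj₂ l
  ... | no ≮x | no ≮y = ⊥-elim (impossible
    (interpolate _ _ x (λ i → <ᵇ-weaken (a i)) (≮⇒≥ ≮x) x≤)
    (interpolate _ _ y (λ j → <ᵇ-weaken (b j)) (≮⇒≥ ≮y) y≤))
    where
    <ᵇ-weaken : ∀ m {n} → (m <ᵇ n) ≡ true → (m <ᵇ suc n) ≡ true
    <ᵇ-weaken m e = <⇒<ᵇ≡true (m≤n⇒m≤1+n (<ᵇ≡true⇒< {m} e))
    -- Raising one threshold by one makes the other alternative of `parking-thresholds` contradict
    -- the violation.
    x≤ : x ≤ cP (suc y)
    x≤ = ≮⇒≥ λ l → case parking-thresholds pf (suc y) x (inj₁ (<-≤-trans l x≤p)) of λ where
      (inj₁ y<) → ≮y y<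
      (inj₂ x≤) → <⇒≱ l x≤
    y≤ : y ≤ cQ (suc x)
    y≤ = ≮⇒≥ λ l → case parking-thresholds pf y (suc x) (inj₂ (<-≤-trans l y≤q)) of λ where
      (inj₁ y≤) → <⇒≱ l y≤
      (inj₂ x<) → ≮x x<
    Between : ∀ {n} → (Fin n → ℕ) → ℕ → ℕ → Set
    Between c t k = ∃ λ χ → # χ ≡ k × (∀ i → (c i <ᵇ t) ≡ true → χ i ≡ true)
      × (∀ i → χ i ≡ true → (c i <ᵇ suc t) ≡ true)
    impossible : Between a y x → Between b x y → ⊥
    -- Matching on `refl` identifies `x` and `y` with the sizes of the chosen sets, so that the
    -- thresholds are those sizes.
    impossible (χ₁ , refl , a<⇒χ₁ , χ₁⇒a≤) (χ₂ , refl , b<⇒χ₂ , χ₂⇒b≤) =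
      prime (χ₁ ⊍ χ₂) nonempty cononempty (decomposable pf χ₁ χ₂ a<⇒χ₁ χ₁⇒a≤ b<⇒χ₂ χ₂⇒b≤)
      where
      nonempty : Nonempty (χ₁ ⊍ χ₂)
      nonempty with # χ₁ ≟ 0 | # χ₂ ≟ 0
      ... | yes e₁ | yes e₂ = ⊥-elim (≢₀ (e₁ , e₂))
      ... | no e₁  | _ with i , e ← 0<#⇒∃true χ₁ (n≢0⇒n>0 e₁) = i ↑ˡ q , true⇒∈ (trans (left-⊍ χ₁ χ₂ i) e)
      ... | yes _  | no e₂ with j , e ← 0<#⇒∃true χ₂ (n≢0⇒n>0 e₂) = p ↑ʳ j , true⇒∈ (trans (right-⊍ χ₁ χ₂ j) e)
      cononempty : Nonempty (∁ (χ₁ ⊍ χ₂))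
      cononempty with # χ₁ ≟ p | # χ₂ ≟ q
      ... | yes e₁ | yes e₂ = ⊥-elim (≢₁ (e₁ , e₂))
      ... | no e₁  | _ with i , e ← #<n⇒∃false χ₁ (≤∧≢⇒< x≤p e₁) = i ↑ˡ q , false⇒∈∁ (trans (left-⊍ χ₁ χ₂ i) e)
      ... | yes _  | no e₂ with j , e ← #<n⇒∃false χ₂ (≤∧≢⇒< y≤q e₂) = p ↑ʳ j , false⇒∈∁ (trans (right-⊍ χ₁ χ₂ j) e)

  -- Irreducibility is used at the pair of sizes of a vertex set in the two parts: the complement of
  -- `S` for parking, and the block `A` for indecomposability. The pigeonhole principle finds a
  -- vertex outside that set whose label is below its number of neighbours inside.
  Irreducible⇒IsPrimePF : 1 ≤ p → 1 ≤ q → (∀ v → 1 ≤ f v) →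
    Irreducible p q (decrement fp) (decrement fq) → IsPrimePF f
  Irreducible⇒IsPrimePF 1≤p 1≤q f≥1 irr = ((λ v _ → f≥1 v) , park) , indecomposable
    where
    irr′ : ∀ x y → x ≤ p → y ≤ q → ¬ (x ≡ 0 × y ≡ 0) → ¬ (x ≡ p × y ≡ q) → x < cP y ⊎ y < cQ x
    irr′ x y rewrite sym (cnt-decrement y fp) | sym (cnt-decrement x fq) = irr x y
    burn-one : ∀ S → Nonempty S → ¬ (# (not ∘ left S) ≡ 0 × # (not ∘ right S) ≡ 0) →
      ∃ λ v → v ∈ₛ S × f v ≤ degOutside ⊤ S v
    burn-one S (v₀ , v₀∈S) ≢₀ with irr′ _ _ (#≤n (not ∘ left S)) (#≤n (not ∘ right S)) ≢₀
      (λ (e₁ , e₂) → ↑-elim p q (λ v → v ∈ₛ S → ⊥)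
        (λ i i∈ → <⇒≢ (false⇒#<n (not ∘ left S) i (cong not (∈⇒true i∈))) e₁)
        (λ j j∈ → <⇒≢ (false⇒#<n (not ∘ right S) j (cong not (∈⇒true j∈))) e₂) v₀ v₀∈S)
    ... | inj₁ l with i , a< , i∈S ← pigeonhole (not ∘ left S) _ l =
      i ↑ˡ q , true⇒∈ (not-false i∈S) ,
      subst₂ _≤_ (sym (f≥1⇒a f≥1 i)) (sym (degOutside-⊤-P S i))
        (m≤n⇒m≤1+n (<ᵇ≡true⇒< {a i} a<))
    ... | inj₂ l with j , b< , j∈S ← pigeonhole (not ∘ right S) _ l =
      p ↑ʳ j , true⇒∈ (not-false j∈S) ,
      subst₂ _≤_ (sym (f≥1⇒b f≥1 j)) (sym (degOutside-⊤-Q S j))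
        (m≤n⇒m≤1+n (<ᵇ≡true⇒< {b j} b<))
    park : ∀ S → S ⊆ₛ ⊤ → Nonempty S → ∃ λ v → v ∈ₛ S × f v ≤ degOutside ⊤ S v
    park S _ ne with # (not ∘ left S) ≟ 0 | # (not ∘ right S) ≟ 0
    ... | no ≢0 | _     = burn-one S ne λ (e , _) → ≢0 e
    ... | yes _ | no ≢0 = burn-one S ne λ (_ , e) → ≢0 e
    -- Here `S` contains every vertex and the sizes give the exempt origin; a vertex of Q with label
    -- zero parks through its edge to the sink.
    ... | yes _ | yes e₂ with j , e ← 0<#⇒∃true _ (subst (0 <_) (cnt-decrement 1 fq)
                                        (irreducible⇒0<cnt (decrement fp) (decrement fq) 1≤p 1≤q irr)) =
      p ↑ʳ j , true⇒∈ (not-false (#≡0⇒false _ e₂ j)) ,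
      subst (_≤ degOutside ⊤ S (p ↑ʳ j))
        (sym (trans (f≥1⇒b f≥1 j) (cong suc (n<1⇒n≡0 (<ᵇ≡true⇒< {b j} e))))) (s≤s z≤n)
    indecomposable : ∀ A → Nonempty A → Nonempty (∁ A) → ¬ Decomposable f A
    indecomposable A (v , v∈A) (w , w∈∁A) (_ , positive , _)
      with irr′ (# (left A)) (# (right A)) (#≤n _) (#≤n _)
             (λ (e₁ , e₂) → ↑-elim p q (λ v → v ∈ₛ A → ⊥)
               (λ i i∈ → <⇒≢ (true⇒0<# (left A) i (∈⇒true i∈)) (sym e₁))
               (λ j j∈ → <⇒≢ (true⇒0<# (right A) j (∈⇒true j∈)) (sym e₂)) v v∈A)
             (λ (e₁ , e₂) → ↑-elim p q (λ w → w ∈ₛ ∁ A → ⊥)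
               (λ i i∈ → <⇒≢ (false⇒#<n (left A) i (∈∁⇒false i∈)) e₁)
               (λ j j∈ → <⇒≢ (false⇒#<n (right A) j (∈∁⇒false j∈)) e₂) w w∈∁A)
    -- This vertex of the second block has value at most its degree into `A`, so the subtraction
    -- leaves 0 and positivity fails.
    ... | inj₁ l with i , a< , i∉A ← pigeonhole (left A) _ l =
      <⇒≢ (positive (i ↑ˡ q) (false⇒∈∁ i∉A)) (sym (m≤n⇒m∸n≡0
        (subst₂ _≤_ (sym (f≥1⇒a f≥1 i)) (sym (deg-↑ˡ p q (lookup A) i)) (<ᵇ≡true⇒< {a i} a<))))
    ... | inj₂ l with j , b< , j∉A ← pigeonhole (right A) _ l =
      <⇒≢ (positive (p ↑ʳ j) (false⇒∈∁ j∉A)) (sym (m≤n⇒m∸n≡0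
        (subst₂ _≤_ (sym (f≥1⇒b f≥1 j)) (sym (deg-↑ʳ p q (lookup A) j)) (<ᵇ≡true⇒< {b j} b<))))

-- Sorted lists and lattice paths.

<⇒⟦⟧≡1 : ∀ {v t} → v < t → ⟦ v <ᵇ t ⟧ ≡ 1
<⇒⟦⟧≡1 l = cong ⟦_⟧ (<⇒<ᵇ≡true l)

≤⇒⟦⟧≡0 : ∀ {v t} → t ≤ v → ⟦ v <ᵇ t ⟧ ≡ 0
≤⇒⟦⟧≡0 l = cong ⟦_⟧ (≤⇒<ᵇ≡false l)

⟦⟧≤1 : ∀ c → ⟦ c ⟧ ≤ 1
⟦⟧≤1 true  = ≤-refl
⟦⟧≤1 false = z≤n

⟦⟧-mono : ∀ v {t t′} → t ≤ t′ → ⟦ v <ᵇ t ⟧ ≤ ⟦ v <ᵇ t′ ⟧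
⟦⟧-mono v {t} {t′} t≤t′ with v <? t
... | yes l = ≤-trans (⟦⟧≤1 (v <ᵇ t)) (≤-reflexive (sym (<⇒⟦⟧≡1 (<-≤-trans l t≤t′))))
... | no  l = ≤-trans (≤-reflexive (≤⇒⟦⟧≡0 {v} (≮⇒≥ l))) z≤n

cnt-mono : ∀ a {t t′} → t ≤ t′ → cnt t a ≤ cnt t′ a
cnt-mono []      l = z≤n
cnt-mono (v ∷ a) l = +-mono-≤ (⟦⟧-mono v l) (cnt-mono a l)

cnt≤length : ∀ t a → cnt t a ≤ length a
cnt≤length t []      = z≤n
cnt≤length t (v ∷ a) = +-mono-≤ (⟦⟧≤1 (v <ᵇ t)) (cnt≤length t a)

All≥⇒cnt≡0 : ∀ {t a} → All (t ≤_) a → cnt t a ≡ 0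
All≥⇒cnt≡0 []       = refl
All≥⇒cnt≡0 {t} {v ∷ a} (l ∷ ls) = cong₂ _+_ (≤⇒⟦⟧≡0 {v} l) (All≥⇒cnt≡0 ls)

All<⇒cnt≡length : ∀ {t a} → All (_< t) a → cnt t a ≡ length a
All<⇒cnt≡length []       = refl
All<⇒cnt≡length (l ∷ ls) = cong₂ _+_ (<⇒⟦⟧≡1 l) (All<⇒cnt≡length ls)

length≤cnt⇒All< : ∀ t a → length a ≤ cnt t a → All (_< t) a
length≤cnt⇒All< t []      l = []
length≤cnt⇒All< t (v ∷ a) l with v <? t
... | yes v<t = v<t ∷ length≤cnt⇒All< t a (s≤s⁻¹ (subst (λ z → suc (length a) ≤ z + cnt t a) (<⇒⟦⟧≡1 v<t) l))
... | no  v≮t = contradiction (≤-trans l (≤-trans (≤-reflexive (cong (_+ cnt t a) (≤⇒⟦⟧≡0 {v} (≮⇒≥ v≮t)))) (cnt≤length t a))) 1+n≰n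

cnt-↭ : ∀ t {a b} → a ↭ b → cnt t a ≡ cnt t b
cnt-↭ t ↭.refl         = refl
cnt-↭ t (↭.prep v r)   = cong (_+_ ⟦ v <ᵇ t ⟧) (cnt-↭ t r)
cnt-↭ t (↭.swap v w r) = trans (cong (λ z → ⟦ v <ᵇ t ⟧ + (⟦ w <ᵇ t ⟧ + z)) (cnt-↭ t r)) (+-swap ⟦ v <ᵇ t ⟧ ⟦ w <ᵇ t ⟧ _)
cnt-↭ t (↭.trans r s)  = trans (cnt-↭ t r) (cnt-↭ t s)

0<cnt⇒head< : ∀ {v a} t → All (v ≤_) a → 0 < cnt t a → v < t
0<cnt⇒head< {v} t ls l = ≰⇒> λ t≤v → <⇒≢ l (sym (All≥⇒cnt≡0 (All.map (≤-trans t≤v) ls)))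

-- The worker functions of perpPath, path, eYs and points are local to Defs;
-- they are named here as the solutions of metavariables.
mutual
  perpFrom : ℕ → List ℕ → ℕ → List ℕ → Path
  perpFrom = _

  perpPath-∷ : ∀ q y a → perpPath q (y ∷ a) ≡ replicate y N ++ E ∷ perpFrom q (y ∷ a) y a
  -- The local worker also carries the whole list as a parameter. Abstracting it leaves distinct
  -- variables as arguments, so the solution is unique.
  perpPath-∷ q y a with y ∷ a
  ... | w = refl

mutual
  pathFrom : ℕ → List ℕ → ℕ → List ℕ → Path
  pathFrom = _

  path-∷ : ∀ p x b → path p (x ∷ b) ≡ replicate x E ++ N ∷ pathFrom p (x ∷ b) x b
  path-∷ p x b with x ∷ b
  ... | w = refl

mutual
  eYsFrom : ℕ → Path → List ℕ
  eYsFrom = _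

  eYs-0 : ∀ s → eYs s ≡ eYsFrom 0 s
  eYs-0 s with 0
  ... | y = refl

mutual
  pointsFrom : ℕ → ℕ → Path → List (ℕ × ℕ)
  pointsFrom = _

  points-E : ∀ s → points (E ∷ s) ≡ (0 , 0) ∷ pointsFrom 1 0 s
  points-E s with 1 | 0
  ... | x | y = refl

pointsFrom-N⁻ : ∀ k x₀ y₀ s {x y} → (x , y) ∈ pointsFrom x₀ y₀ (replicate k N ++ s) →
  (x ≡ x₀ × y₀ ≤ y × y < k + y₀) ⊎ (x , y) ∈ pointsFrom x₀ (k + y₀) s
pointsFrom-N⁻ zero    x₀ y₀ s m           = inj₂ m
pointsFrom-N⁻ (suc k) x₀ y₀ s (here refl) = inj₁ (refl , ≤-refl , s≤s (m≤n+m y₀ k))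
pointsFrom-N⁻ (suc k) x₀ y₀ s {x} {y} (there m) with pointsFrom-N⁻ k x₀ (suc y₀) s m
... | inj₁ (e , l , u) = inj₁ (e , <⇒≤ l , subst (y <_) (+-suc k y₀) u)
... | inj₂ m′          = inj₂ (subst (λ z → (x , y) ∈ pointsFrom x₀ z s) (+-suc k y₀) m′)

pointsFrom-N⁺ : ∀ k x₀ y₀ s {x y} →
  (x ≡ x₀ × y₀ ≤ y × y < k + y₀) ⊎ (x , y) ∈ pointsFrom x₀ (k + y₀) s →
  (x , y) ∈ pointsFrom x₀ y₀ (replicate k N ++ s)
pointsFrom-N⁺ zero    x₀ y₀ s (inj₁ (_ , l , u)) = contradiction l (<⇒≱ u)
pointsFrom-N⁺ zero    x₀ y₀ s (inj₂ m)           = m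
pointsFrom-N⁺ (suc k) x₀ y₀ s {x} {y} (inj₁ (refl , l , u)) with y₀ ≟ y
... | yes refl = here refl
... | no  ≢    = there (pointsFrom-N⁺ k x₀ (suc y₀) s (inj₁ (refl , ≤∧≢⇒< l ≢ , subst (y <_) (sym (+-suc k y₀)) u)))
pointsFrom-N⁺ (suc k) x₀ y₀ s {x} {y} (inj₂ m) =
  there (pointsFrom-N⁺ k x₀ (suc y₀) s (inj₂ (subst (λ z → (x , y) ∈ pointsFrom x₀ z s) (sym (+-suc k y₀)) m)))

-- At height `y` the path runs from the number of E steps strictly below `y` to the number of E
-- steps at height at most `y`, counted from `x₀`.
OnPerp : ℕ → ℕ → ℕ → List ℕ → ℕ → ℕ → Set
OnPerp q x₀ y₀ a x y = y₀ ≤ y × y ≤ q × x₀ + cnt y a ≤ x × x ≤ x₀ + cnt (suc y) a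

perp-points⁻ : ∀ q w x₀ y₀ a {x y} → AllPairs _≤_ a → All (y₀ ≤_) a → All (_≤ q) a → y₀ ≤ q →
  (x , y) ∈ pointsFrom x₀ y₀ (perpFrom q w y₀ a) → OnPerp q x₀ y₀ a x y
perp-points⁻ q w x₀ y₀ [] {x} {y} sorted low high y₀≤q m
  with pointsFrom-N⁻ (q ∸ y₀) x₀ y₀ [] (subst (λ s → (x , y) ∈ pointsFrom x₀ y₀ s) (sym (++-identityʳ _)) m)
... | inj₁ (refl , l , u) = l , <⇒≤ (subst (y <_) (m∸n+n≡m y₀≤q) u) , ≤-reflexive (+-identityʳ x) , m≤m+n x 0
... | inj₂ (here refl) rewrite m∸n+n≡m y₀≤q = y₀≤q , ≤-refl , ≤-reflexive (+-identityʳ x) , m≤m+n x 0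
perp-points⁻ q w x₀ y₀ (v ∷ a) {x} {y} (v≤a ∷ sorted) (y₀≤v ∷ _) (v≤q ∷ high) y₀≤q m
  with pointsFrom-N⁻ (v ∸ y₀) x₀ y₀ (E ∷ perpFrom q w v a) m
... | inj₁ (refl , l , u) rewrite m∸n+n≡m y₀≤v =
  l , ≤-trans (<⇒≤ u) v≤q ,
  ≤-reflexive (trans (cong (_+_ x) (All≥⇒cnt≡0 {y} (<⇒≤ u ∷ All.map (≤-trans (<⇒≤ u)) v≤a))) (+-identityʳ x)) ,
  m≤m+n x _
... | inj₂ (here refl) rewrite m∸n+n≡m y₀≤v =
  y₀≤v , v≤q ,
  ≤-reflexive (trans (cong (_+_ x) (All≥⇒cnt≡0 {v} (≤-refl ∷ v≤a))) (+-identityʳ x)) ,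
  m≤m+n x _
... | inj₂ (there m′) rewrite m∸n+n≡m y₀≤v
  with v≤y , y≤q , l , u ← perp-points⁻ q w (suc x₀) v a sorted v≤a high v≤q m′ =
  ≤-trans y₀≤v v≤y , y≤q ,
  ≤-trans (≤-trans (+-monoʳ-≤ x₀ (+-monoˡ-≤ (cnt y a) (⟦⟧≤1 (v <ᵇ y)))) (≤-reflexive (+-suc x₀ _))) l ,
  ≤-trans u (≤-reflexive (trans (sym (+-suc x₀ _)) (cong (λ z → x₀ + (z + cnt (suc y) a)) (sym (<⇒⟦⟧≡1 {v} (s≤s v≤y))))))

perp-points⁺ : ∀ q w x₀ y₀ a {x y} → AllPairs _≤_ a → All (y₀ ≤_) a → y₀ ≤ q →
  OnPerp q x₀ y₀ a x y → (x , y) ∈ pointsFrom x₀ y₀ (perpFrom q w y₀ a)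
perp-points⁺ q w x₀ y₀ [] {x} {y} sorted low y₀≤q (y₀≤y , y≤q , l , u)
  with refl ← ≤-antisym (≤-trans u (≤-reflexive (+-identityʳ x₀))) (≤-trans (m≤m+n x₀ 0) l) =
  subst (λ s → (x , y) ∈ pointsFrom x₀ y₀ s) (++-identityʳ _)
    (pointsFrom-N⁺ (q ∸ y₀) x₀ y₀ [] (end (y ≟ q)))
  where
  end : _ → (x ≡ x₀ × y₀ ≤ y × y < q ∸ y₀ + y₀) ⊎ (x , y) ∈ pointsFrom x₀ (q ∸ y₀ + y₀) []
  end (yes refl) rewrite m∸n+n≡m y₀≤q = inj₂ (here refl)
  end (no ≢)     rewrite m∸n+n≡m y₀≤q = inj₁ (refl , y₀≤y , ≤∧≢⇒< y≤q ≢)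
perp-points⁺ q w x₀ y₀ (v ∷ a) {x} {y} (v≤a ∷ sorted) (y₀≤v ∷ _) y₀≤q (y₀≤y , y≤q , l , u) =
  pointsFrom-N⁺ (v ∸ y₀) x₀ y₀ (E ∷ perpFrom q w v a) place
  where
  place : (x ≡ x₀ × y₀ ≤ y × y < v ∸ y₀ + y₀) ⊎ (x , y) ∈ pointsFrom x₀ (v ∸ y₀ + y₀) (E ∷ perpFrom q w v a)
  place rewrite m∸n+n≡m y₀≤v with v ≤? y
  ... | no v≰y = inj₁ (≤-antisym
      (≤-trans u (≤-reflexive (trans (cong (_+_ x₀) (All≥⇒cnt≡0 {suc y} (y<v ∷ All.map (≤-trans y<v) v≤a))) (+-identityʳ x₀))))
      (≤-trans (m≤m+n x₀ _) l) , y₀≤y , y<v)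
    where
    y<v : y < v
    y<v = ≰⇒> v≰y
  ... | yes v≤y with v <? y
  ...   | yes v<y = inj₂ (there (perp-points⁺ q w (suc x₀) v a sorted v≤a (≤-trans v≤y y≤q) (v≤y , y≤q ,
      ≤-trans (≤-reflexive (trans (sym (+-suc x₀ _)) (cong (λ z → x₀ + (z + cnt y a)) (sym (<⇒⟦⟧≡1 v<y))))) l ,
      ≤-trans u (≤-reflexive (trans (cong (λ z → x₀ + (z + cnt (suc y) a)) (<⇒⟦⟧≡1 {v} (s≤s v≤y))) (+-suc x₀ _))))))
  -- At the height of the next E step, the point is either where that step begins or lies on the
  -- path after it.
  ...   | no v≮y with refl ← ≤-antisym v≤y (≮⇒≥ v≮y) with x ≟ x₀
  ...     | yes refl = inj₂ (here refl)
  ...     | no  ≢    = inj₂ (there (perp-points⁺ q w (suc x₀) v a sorted v≤a y≤q (≤-refl , y≤q ,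
      ≤-trans (≤-reflexive (cong (_+_ (suc x₀)) (All≥⇒cnt≡0 v≤a)))
        (≤-trans (≤-reflexive (+-identityʳ (suc x₀))) (≤∧≢⇒< (≤-trans (m≤m+n x₀ _) l) (≢ ∘ sym))) ,
      ≤-trans u (≤-reflexive (trans (cong (λ z → x₀ + (z + cnt (suc y) a)) (<⇒⟦⟧≡1 {v} ≤-refl)) (+-suc x₀ _))))))

flip : Step → Step
flip E = N
flip N = E

-- The two families of paths are mirror images in the diagonal, which transfers the description of
-- points from one to the other.
pathFrom≡flip : ∀ p w x b → pathFrom p w x b ≡ map flip (perpFrom p w x b)
pathFrom≡flip p w x []      = sym (map-replicate flip (p ∸ x) N)
pathFrom≡flip p w x (v ∷ b) = trans
  (cong₂ (λ r s → r ++ N ∷ s) (sym (map-replicate flip (v ∸ x) N)) (pathFrom≡flip p w v b))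
  (sym (map-++ flip (replicate (v ∸ x) N) _))

pointsFrom-flip : ∀ x y s → pointsFrom x y (map flip s) ≡ map swap (pointsFrom y x s)
pointsFrom-flip x y []      = refl
pointsFrom-flip x y (E ∷ s) = cong (_ ∷_) (pointsFrom-flip x (suc y) s)
pointsFrom-flip x y (N ∷ s) = cong (_ ∷_) (pointsFrom-flip (suc x) y s)

path-points⁻ : ∀ p b {x y} → (x , y) ∈ points (path p b) → (y , x) ∈ points (perpPath p b)
path-points⁻ p b {x} {y} m
  with (_ , _) , m′ , refl ← ∈-map⁻ swap (subst ((x , y) ∈_) (trans (cong points (pathFrom≡flip p b 0 b)) (pointsFrom-flip 0 0 (perpPath p b))) m) = m′

path-points⁺ : ∀ p b {x y} → (y , x) ∈ points (perpPath p b) → (x , y) ∈ points (path p b)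
path-points⁺ p b {x} {y} m = subst ((x , y) ∈_)
  (sym (trans (cong points (pathFrom≡flip p b 0 b)) (pointsFrom-flip 0 0 (perpPath p b)))) (∈-map⁺ swap m)

eYsFrom-N : ∀ k y s → eYsFrom y (replicate k N ++ s) ≡ eYsFrom (k + y) s
eYsFrom-N zero    y s = refl
eYsFrom-N (suc k) y s = trans (eYsFrom-N k (suc y) s) (cong (λ z → eYsFrom z s) (+-suc k y))

eYsFrom-E : ∀ k y s → eYsFrom y (replicate k E ++ s) ≡ replicate k y ++ eYsFrom y s
eYsFrom-E zero    y s = refl
eYsFrom-E (suc k) y s = cong (y ∷_) (eYsFrom-E k y s)

eYs-perp : ∀ q w y a → AllPairs _≤_ a → All (y ≤_) a → eYsFrom y (perpFrom q w y a) ≡ a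
eYs-perp q w y [] _ _ = trans (cong (eYsFrom y) (sym (++-identityʳ (replicate (q ∸ y) N)))) (eYsFrom-N (q ∸ y) y [])
eYs-perp q w y (v ∷ a) (v≤a ∷ sorted) (y≤v ∷ _) =
  trans (eYsFrom-N (v ∸ y) y (E ∷ perpFrom q w v a))
    (trans (cong (λ z → z ∷ eYsFrom z (perpFrom q w v a)) (m∸n+n≡m y≤v))
      (cong (v ∷_) (eYs-perp q w v a sorted v≤a)))

applyUpTo-cong : ∀ {f g : ℕ → ℕ} → (∀ i → f i ≡ g i) → ∀ n → applyUpTo f n ≡ applyUpTo g n
applyUpTo-cong e zero    = refl
applyUpTo-cong e (suc n) = cong₂ _∷_ (e 0) (applyUpTo-cong (e ∘ suc) n)

replicate-++-applyUpTo : ∀ k {y} n (f : ℕ → ℕ) → (∀ i → i < k → f i ≡ y) →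
  replicate k y ++ applyUpTo (λ i → f (k + i)) n ≡ applyUpTo f (k + n)
replicate-++-applyUpTo zero    n f e = refl
replicate-++-applyUpTo (suc k) n f e =
  cong₂ _∷_ (sym (e 0 (s≤s z≤n))) (replicate-++-applyUpTo k n (f ∘ suc) λ i l → e (suc i) (s≤s l))

-- The E step that starts at x-coordinate `x + i` is preceded by the N steps at x-coordinate at most
-- `x + i`, hence the threshold `suc (x + i)`.
eYs-path : ∀ p w x y b → AllPairs _≤_ b → All (x ≤_) b → All (_≤ p) b →
  eYsFrom y (pathFrom p w x b) ≡ applyUpTo (λ i → y + cnt (suc (x + i)) b) (p ∸ x)
eYs-path p w x y [] _ _ _ = begin
  eYsFrom y (replicate (p ∸ x) E)             ≡⟨ cong (eYsFrom y) (sym (++-identityʳ (replicate (p ∸ x) E))) ⟩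
  eYsFrom y (replicate (p ∸ x) E ++ [])       ≡⟨ eYsFrom-E (p ∸ x) y [] ⟩
  replicate (p ∸ x) y ++ []                   ≡⟨ replicate-++-applyUpTo (p ∸ x) 0 (λ _ → y + 0) (λ _ _ → +-identityʳ y) ⟩
  applyUpTo (λ i → y + 0) (p ∸ x + 0)         ≡⟨ cong (applyUpTo (λ i → y + 0)) (+-identityʳ (p ∸ x)) ⟩
  applyUpTo (λ i → y + 0) (p ∸ x)             ∎
  where open ≡-Reasoning
eYs-path p w x y (v ∷ b) (v≤b ∷ sorted) (x≤v ∷ _) (v≤p ∷ high) = begin
  eYsFrom y (replicate k E ++ N ∷ pathFrom p w v b)
    ≡⟨ eYsFrom-E k y _ ⟩
  replicate k y ++ eYsFrom (suc y) (pathFrom p w v b)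
    ≡⟨ cong (replicate k y ++_) (eYs-path p w v (suc y) b sorted v≤b high) ⟩
  replicate k y ++ applyUpTo (λ i → suc y + cnt (suc (v + i)) b) (p ∸ v)
    ≡⟨ cong (replicate k y ++_) (applyUpTo-cong above (p ∸ v)) ⟩
  replicate k y ++ applyUpTo (λ i → f (k + i)) (p ∸ v)
    ≡⟨ replicate-++-applyUpTo k (p ∸ v) f below ⟩
  applyUpTo f (k + (p ∸ v))
    ≡⟨ cong (applyUpTo f) total ⟩
  applyUpTo f (p ∸ x) ∎
  where
  open ≡-Reasoning
  k = v ∸ x
  f : ℕ → ℕ
  f i = y + cnt (suc (x + i)) (v ∷ b)
  x+k : x + k ≡ v
  x+k = m+[n∸m]≡n x≤v
  above : ∀ i → suc y + cnt (suc (v + i)) b ≡ f (k + i)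
  above i rewrite sym (+-assoc x k i) | x+k | <⇒⟦⟧≡1 {v} {suc (v + i)} (s≤s (m≤m+n v i)) = sym (+-suc y _)
  below : ∀ i → i < k → f i ≡ y
  below i l = trans (cong (_+_ y) (All≥⇒cnt≡0 {suc (x + i)} (le ∷ All.map (≤-trans le) v≤b))) (+-identityʳ y)
    where
    le : suc (x + i) ≤ v
    le = subst₂ _≤_ (+-suc x i) x+k (+-monoʳ-≤ x l)
  total : k + (p ∸ v) ≡ p ∸ x
  total = trans (sym (+-∸-comm (p ∸ v) x≤v)) (cong (_∸ x) (m+[n∸m]≡n v≤p))

-- In a sorted list, if the entry with index `i`, counted from 0, is at most a bound, then so are
-- all the entries before it.
above⇒cnt : ∀ n f a → AllPairs _≤_ a → Pointwise (λ y y′ → y′ ≤ y) (applyUpTo f n) a →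
  ∀ i → i < n → i < cnt (suc (f i)) a
above⇒cnt (suc n) f (v ∷ a) (v≤a ∷ sorted) (l ∷ ls) zero    _ =
  subst (λ z → 0 < z + cnt (suc (f 0)) a) (sym (<⇒⟦⟧≡1 (s≤s l))) (s≤s z≤n)
above⇒cnt (suc n) f (v ∷ a) (v≤a ∷ sorted) (l ∷ ls) (suc i) i<n
  with l′ ← above⇒cnt n (f ∘ suc) a sorted ls i (s≤s⁻¹ i<n) =
  subst (λ z → suc i < z + cnt (suc (f (suc i))) a)
    (sym (<⇒⟦⟧≡1 (0<cnt⇒head< _ v≤a (≤-trans (s≤s z≤n) l′)))) (s≤s l′)

cnt⇒above : ∀ n f a → AllPairs _≤_ a → length a ≡ n → (∀ i → i < n → i < cnt (suc (f i)) a) →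
  Pointwise (λ y y′ → y′ ≤ y) (applyUpTo f n) a
cnt⇒above zero    f []      _ _ _ = []
cnt⇒above (suc n) f (v ∷ a) (v≤a ∷ sorted) e h =
  s≤s⁻¹ (0<cnt⇒head< (suc (f 0)) (≤-refl ∷ v≤a) (h 0 (s≤s z≤n))) ∷
  cnt⇒above n (f ∘ suc) a sorted (suc-injective e) λ i l →
    s≤s⁻¹ (≤-trans (h (suc i) (s≤s l)) (+-monoˡ-≤ _ (⟦⟧≤1 (v <ᵇ suc (f (suc i))))))

-- Irreducibility at `(p - 1 , q)`: the second alternative would need more than `q` entries in `b`,
-- so all `p` entries of `a` are below `q`.
irreducible-bound : ∀ {p q} a b → 1 ≤ p → 1 ≤ q → length a ≡ p → length b ≡ q →
  Irreducible p q a b → All (_< q) a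
irreducible-bound {suc P} {q} a b _ 1≤q ea eb irr
  with irr P q (n≤1+n P) ≤-refl (λ (_ , e) → <⇒≢ 1≤q (sym e)) (λ (e , _) → 1+n≢n (sym e))
... | inj₁ l = length≤cnt⇒All< q a (subst (_≤ cnt q a) (sym ea) l)
... | inj₂ l = contradiction (≤-trans (cnt≤length P b) (≤-reflexive eb)) (<⇒≱ l)

module Lattice {p q : ℕ} {a b : List ℕ} (sorted-a : AllPairs _≤_ a) (sorted-b : AllPairs _≤_ b)
  (length-a : length a ≡ p) (length-b : length b ≡ q) (a≤q : All (_≤ q) a) (b≤p : All (_≤ p) b) where

  private
    0≤ : ∀ (c : List ℕ) → All (0 ≤_) c
    0≤ c = All.universal (λ _ → z≤n) c

    above-eq : ∀ {R : List ℕ → List ℕ → Set} →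
      R (eYs (path p b)) (eYs (perpPath q a)) ≡ R (applyUpTo (λ i → cnt (suc i) b) p) a
    above-eq {R} = cong₂ R (eYs-path p b 0 0 b sorted-b (0≤ b) b≤p) (eYs-perp q a 0 a sorted-a (0≤ a))

  Noncrossing : Set
  Noncrossing = WeaklyAbove (path p b) (perpPath q a) ×
    (∀ pt → pt ∈ points (perpPath q a) → pt ∈ points (path p b) → pt ≡ (0 , 0) ⊎ pt ≡ (p , q))

  -- A violating point satisfies the lower bounds for lying on each path. Weak aboveness supplies
  -- the upper bounds, so the point is common to both paths and must be a corner.
  noncrossing⇒irreducible : Noncrossing → Irreducible p q a b
  noncrossing⇒irreducible (above , meet) x y x≤p y≤q ≢₀ ≢₁ with x <? cnt y a | y <? cnt x b
  ... | yes l | _     = inj₁ l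
  ... | no _  | yes l = inj₂ l
  ... | no ≮x | no ≮y = case meet (x , y)
      (perp-points⁺ q a 0 0 a sorted-a (0≤ a) z≤n (z≤n , y≤q , ≮⇒≥ ≮x , x≤ x x≤p (≮⇒≥ ≮y)))
      (path-points⁺ p b (perp-points⁺ p b 0 0 b sorted-b (0≤ b) z≤n (z≤n , x≤p , ≮⇒≥ ≮y , y≤))) of λ where
        (inj₁ refl) → ⊥-elim (≢₀ (refl , refl))
        (inj₂ refl) → ⊥-elim (≢₁ (refl , refl))
    where
    above′ : ∀ i → i < p → i < cnt (suc (cnt (suc i) b)) a
    above′ = above⇒cnt p _ a sorted-a (subst (λ S → S) (above-eq {Pointwise (λ y y′ → y′ ≤ y)}) above)
    x≤ : ∀ x → x ≤ p → cnt x b ≤ y → x ≤ cnt (suc y) a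
    x≤ zero    _   _ = z≤n
    x≤ (suc i) i<p l = ≤-trans (above′ i i<p) (cnt-mono a (s≤s l))
    y≤ : y ≤ cnt (suc x) b
    -- In the last column all `q` entries of `b` count; elsewhere a failure would give `x < cnt y a`
    -- through the E step that starts at `x`.
    y≤ with x ≟ p
    ... | yes refl = ≤-trans y≤q (≤-reflexive (sym (trans (All<⇒cnt≡length (All.map s≤s b≤p)) length-b)))
    ... | no  ≢p   = ≮⇒≥ λ l → ≮x (≤-trans (above′ x (≤∧≢⇒< x≤p ≢p)) (cnt-mono a l))

  irreducible⇒noncrossing : Irreducible p q a b → Noncrossing
  irreducible⇒noncrossing irr = subst (λ S → S) (sym (above-eq {Pointwise (λ y y′ → y′ ≤ y)}))
    (cnt⇒above p _ a sorted-a length-a above) , meet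
    where
    cnt≤q : ∀ t → cnt t b ≤ q
    cnt≤q t = ≤-trans (cnt≤length t b) (≤-reflexive length-b)
    inner : ∀ i → i < p → ¬ (suc i ≡ p × cnt (suc i) b ≡ q) → i < cnt (suc (cnt (suc i) b)) a
    -- The height is chosen as `cnt (suc i) b`, which makes the second alternative a strict
    -- inequality of a number with itself.
    inner i i<p ≢₁ with irr (suc i) (cnt (suc i) b) i<p (cnt≤q (suc i)) (λ { (() , _) }) ≢₁
    ... | inj₁ l = ≤-trans (<⇒≤ l) (cnt-mono a (n≤1+n _))
    ... | inj₂ l = contradiction l (<-irrefl refl)
    above : ∀ i → i < p → i < cnt (suc (cnt (suc i) b)) a
    above i i<p with suc i ≟ p | cnt (suc i) b ≟ q
    ... | no ≢  | _     = inner i i<p λ (e , _) → ≢ e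
    ... | yes _ | no ≢  = inner i i<p λ (_ , e) → ≢ e
    -- At the exempt corner the bound by `q` on the entries of `a` takes the place of
    -- irreducibility.
    ... | yes e | yes e′ = ≤-trans (≤-reflexive (trans e (sym length-a)))
      (≤-reflexive (sym (All<⇒cnt≡length (All.map (λ l → s≤s (≤-trans l (≤-reflexive (sym e′)))) a≤q))))
    meet : ∀ pt → pt ∈ points (perpPath q a) → pt ∈ points (path p b) → pt ≡ (0 , 0) ⊎ pt ≡ (p , q)
    meet (x , y) m m′
      with _ , y≤q , l , _ ← perp-points⁻ q a 0 0 a sorted-a (0≤ a) a≤q z≤n m
         | _ , x≤p , l′ , _ ← perp-points⁻ p b 0 0 b sorted-b (0≤ b) b≤p z≤n (path-points⁻ p b m′)
      with x ≟ 0 ×-dec y ≟ 0 | x ≟ p ×-dec y ≟ q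
    ... | yes (refl , refl) | _ = inj₁ refl
    ... | no _ | yes (refl , refl) = inj₂ refl
    ... | no ≢₀ | no ≢₁ with irr x y x≤p y≤q ≢₀ ≢₁
    ...   | inj₁ l″ = contradiction l (<⇒≱ l″)
    ...   | inj₂ l″ = contradiction l′ (<⇒≱ l″)

-- Both notions of primality as irreducibility.

Positive : ∀ {n} → Vec ℕ n → Set
Positive f = All (1 ≤_) (toList f)

lookup⇒All : ∀ {n} {R : ℕ → Set} (f : Vec ℕ n) → (∀ i → R (lookup f i)) → All R (toList f)
lookup⇒All []      h = []
lookup⇒All (x ∷ f) h = h zero ∷ lookup⇒All f (h ∘ suc)

All⇒lookup : ∀ {n} {R : ℕ → Set} (f : Vec ℕ n) → All R (toList f) → ∀ i → R (lookup f i)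
All⇒lookup (x ∷ f) (h ∷ hs) zero    = h
All⇒lookup (x ∷ f) (h ∷ hs) (suc i) = All⇒lookup f hs i

length-decrement : ∀ {n} (f : Vec ℕ n) → length (decrement f) ≡ n
length-decrement f = trans (length-map _ (toList f)) (length-toList f)

-- Threshold counts ignore order, which bridges the sorted vectors of the paths and the unsorted
-- labels of the graph.
Irreducible-↭ : ∀ {p q a a′ b b′} → a ↭ a′ → b ↭ b′ → Irreducible p q a b → Irreducible p q a′ b′
Irreducible-↭ ra rb irr x y rewrite sym (cnt-↭ y ra) | sym (cnt-↭ x rb) = irr x y

module _ {p q : ℕ} (1≤p : 1 ≤ p) (1≤q : 1 ≤ q) (fp : Vec ℕ p) (fq : Vec ℕ q) where
  private
    a = decrement fp
    b = decrement fq
    a′ = aVec p q fp fq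
    b′ = bVec p q fp fq

    a′↭a : a′ ↭ a
    a′↭a = ↭-map⁺ _ (sort-↭ (toList fp))

    b′↭b : b′ ↭ b
    b′↭b = ↭-map⁺ _ (sort-↭ (toList fq))

    sorted : ∀ xs → AllPairs _≤_ (map (λ x → x ∸ 1) (sort xs))
    sorted xs = AllPairs.map⁺ (AllPairs.map (∸-monoˡ-≤ 1) (Sorted⇒AllPairs ≤-totalOrder (sort-↗ xs)))

    length-a′ : length a′ ≡ p
    length-a′ = trans (↭-length a′↭a) (length-decrement fp)

    length-b′ : length b′ ≡ q
    length-b′ = trans (↭-length b′↭b) (length-decrement fq)

  IsPPF-K⇔ : IsPPF-K p q fp fq ⇔ (Positive fp × Positive fq × Irreducible p q a b)
  IsPPF-K⇔ = mk⇔ to from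
    where
    open Decomposition fp fq
    to : IsPPF-K p q fp fq → Positive fp × Positive fq × Irreducible p q a b
    to prime@((f≥1 , _) , _) =
      lookup⇒All fp (λ i → subst (1 ≤_) (lookup-++ˡ fp fq i) (f≥1 (i ↑ˡ q) ∈⊤)) ,
      lookup⇒All fq (λ j → subst (1 ≤_) (lookup-++ʳ fp fq j) (f≥1 (p ↑ʳ j) ∈⊤)) ,
      IsPrimePF⇒Irreducible prime
    from : Positive fp × Positive fq × Irreducible p q a b → IsPPF-K p q fp fq
    from (fp≥1 , fq≥1 , irr) = Irreducible⇒IsPrimePF 1≤p 1≤q
      (↑-elim p q _ (λ i → subst (1 ≤_) (sym (lookup-++ˡ fp fq i)) (All⇒lookup fp fp≥1 i))
                    (λ j → subst (1 ≤_) (sym (lookup-++ʳ fp fq j)) (All⇒lookup fq fq≥1 j))) irr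

  IsPPFpq⇔ : IsPPFpq p q fp fq ⇔ (Positive fp × Positive fq × Irreducible p q a b)
  IsPPFpq⇔ = mk⇔ to from
    where
    to : IsPPFpq p q fp fq → Positive fp × Positive fq × Irreducible p q a b
    to ((fp-range , fq-range , above) , meet) =
      All.map proj₁ fp-range , All.map proj₁ fq-range ,
      Irreducible-↭ a′↭a b′↭b
        (noncrossing⇒irreducible (above , meet))
      where
      bounded : ∀ {k xs} → All (λ x → 1 ≤ x × x ≤ suc k) xs → All (_≤ k) (map (λ x → x ∸ 1) (sort xs))
      bounded {k} {xs} range = All.map⁺ (All.map (λ (_ , x≤) → ∸-monoˡ-≤ 1 x≤) (All-resp-↭ (↭-sym (sort-↭ xs)) range))
      open Lattice (sorted (toList fp)) (sorted (toList fq)) length-a′ length-b′ (bounded fp-range) (bounded fq-range)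
    from : Positive fp × Positive fq × Irreducible p q a b → IsPPFpq p q fp fq
    from (fp≥1 , fq≥1 , irr) =
      (range fp fp≥1 a<q , range fq fq≥1 b<p , proj₁ noncrossing) , proj₂ noncrossing
      where
      a<q : All (_< q) a
      a<q = irreducible-bound a b 1≤p 1≤q (length-decrement fp) (length-decrement fq) irr
      b<p : All (_< p) b
      b<p = irreducible-bound b a 1≤q 1≤p (length-decrement fq) (length-decrement fp) (Irreducible-swap a b irr)
      range : ∀ {n k} (f : Vec ℕ n) → Positive f → All (_< k) (decrement f) → All (λ x → 1 ≤ x × x ≤ suc k) (toList f)
      range {k = k} f f≥1 f< = All.zipWith (λ { {suc x} (1≤x , x<) → 1≤x , m≤n⇒m≤1+n x< }) (f≥1 , All.map⁻ f<)
      open Lattice (sorted (toList fp)) (sorted (toList fq)) length-a′ length-b′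
        (All.map <⇒≤ (All-resp-↭ (↭-sym a′↭a) a<q)) (All.map <⇒≤ (All-resp-↭ (↭-sym b′↭b) b<p))
      noncrossing : Noncrossing
      noncrossing = irreducible⇒noncrossing
        (Irreducible-↭ (↭-sym a′↭a) (↭-sym b′↭b) irr)

-- Enumeration of the prime parking functions.

words : ℕ → ∀ n → List (Vec ℕ n)
words K zero    = [] ∷ []
words K (suc n) = cartesianProductWith _∷_ (applyUpTo suc K) (words K n)

words-unique : ∀ K n → Unique (words K n)
words-unique K zero    = [] ∷ []
words-unique K (suc n) = Unique.cartesianProductWith⁺ _∷_ ∷-injective
  (Unique.applyUpTo⁺₁ suc K λ i<j _ e → <⇒≢ i<j (suc-injective e)) (words-unique K n)

∈-words⁺ : ∀ {K n} (f : Vec ℕ n) → Positive f → All (_< K) (decrement f) → f ∈ words K n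
∈-words⁺ []          _        _        = here refl
∈-words⁺ (suc x ∷ f) (_ ∷ f≥1) (x< ∷ f<) = ∈-cartesianProductWith⁺ _∷_ (∈-applyUpTo⁺ suc x<) (∈-words⁺ f f≥1 f<)

∈-words⁻ : ∀ {K n} (f : Vec ℕ n) → f ∈ words K n → Positive f
∈-words⁻ []      _ = []
∈-words⁻ {K} {suc n} (x ∷ f) m
  with _ , _ , x∈ , f∈ , refl ← ∈-cartesianProductWith⁻ _∷_ (applyUpTo suc K) (words K n) m
  with _ , _ , refl ← ∈-applyUpTo⁻ suc x∈ = s≤s z≤n ∷ ∈-words⁻ f f∈

sum-cartesianProductWith : ∀ {A B C : Set} (F : C → ℕ) (g : A → B → C) xs ys →
  sum (map F (cartesianProductWith g xs ys)) ≡ sum (map (λ x → sum (map (λ y → F (g x y)) ys)) xs)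
sum-cartesianProductWith F g []       ys = refl
sum-cartesianProductWith F g (x ∷ xs) ys = begin
  sum (map F (map (g x) ys ++ products))              ≡⟨ cong sum (map-++ F (map (g x) ys) products) ⟩
  sum (map F (map (g x) ys) ++ map F products)        ≡⟨ sum-++ (map F (map (g x) ys)) _ ⟩
  sum (map F (map (g x) ys)) + sum (map F products)   ≡⟨ cong₂ _+_ (cong sum (sym (map-∘ ys))) (sum-cartesianProductWith F g xs ys) ⟩
  sum (map (λ y → F (g x y)) ys) + sum (map (λ x → sum (map (λ y → F (g x y)) ys)) xs) ∎
  where
  open ≡-Reasoning
  products = cartesianProductWith g xs ys

sum-applyUpTo : ∀ (F g : ℕ → ℕ) K → sum (map F (applyUpTo g K)) ≡ Σ< K (F ∘ g)
sum-applyUpTo F g zero    = refl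
sum-applyUpTo F g (suc K) = cong (_+_ (F (g 0))) (sum-applyUpTo F (g ∘ suc) K)

-- The letters of `words` start at 1, so after `decrement` they run through the range summed by `∑`.
sum-words : ∀ K n (F : List ℕ → ℕ) → sum (map (λ f → F (decrement f)) (words K n)) ≡ ∑ K n F
sum-words K zero    F = +-identityʳ (F [])
sum-words K (suc n) F = begin
  sum (map (λ f → F (decrement f)) (words K (suc n)))
    ≡⟨ sum-cartesianProductWith _ _∷_ (applyUpTo suc K) (words K n) ⟩
  sum (map (λ x → sum (map (λ f → F (x ∸ 1 ∷ decrement f)) (words K n))) (applyUpTo suc K))
    ≡⟨ sum-applyUpTo _ suc K ⟩
  Σ< K (λ w → sum (map (λ f → F (w ∷ decrement f)) (words K n)))
    ≡⟨ Σ<-cong K (λ w → sum-words K n λ a → F (w ∷ a)) ⟩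
  ∑ K (suc n) F ∎
  where open ≡-Reasoning

length-filter-T : ∀ {A : Set} (φ : A → Bool) xs → length (filter (T? ∘ φ) xs) ≡ sum (map (λ x → ⟦ φ x ⟧) xs)
length-filter-T φ []       = refl
length-filter-T φ (x ∷ xs) with φ x
... | true  = cong suc (length-filter-T φ xs)
... | false = length-filter-T φ xs

module _ (P Q : ℕ) where
  private
    p = suc P
    q = suc Q
    φ : Vec ℕ p × Vec ℕ q → Bool
    -- The fuel is the number of non-sink vertices.
    φ (fp , fq) = primeᵇ (p + q) (decrement fp) (decrement fq)

  primeList : List (Vec ℕ p × Vec ℕ q)
  primeList = filter (T? ∘ φ) (cartesianProduct (words q p) (words p q))

  primeList-unique : Unique primeList
  primeList-unique = Unique.filter⁺ (T? ∘ φ) (Unique.cartesianProduct⁺ (words-unique q p) (words-unique p q))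

  ∈-primeList : ∀ fp fq → (fp , fq) ∈ primeList ⇔ IsPPF-K p q fp fq
  ∈-primeList fp fq = mk⇔ to from
    where
    a = decrement fp
    b = decrement fq
    open Equivalence (IsPPF-K⇔ (s≤s z≤n) (s≤s z≤n) fp fq) renaming (to to fromK; from to toK)
    fuel : length a + length b ≤ p + q
    fuel = ≤-reflexive (cong₂ _+_ (length-decrement fp) (length-decrement fq))
    to : (fp , fq) ∈ primeList → IsPPF-K p q fp fq
    to m with m′ , prime ← ∈-filter⁻ (T? ∘ φ) {xs = cartesianProduct (words q p) (words p q)} m
         with fp∈ , fq∈ ← ∈-cartesianProduct⁻ (words q p) (words p q) m′ =
      toK (∈-words⁻ fp fp∈ , ∈-words⁻ fq fq∈ ,
        subst₂ (λ m n → Irreducible m n a b) (length-decrement fp) (length-decrement fq)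
          (prime⇒irreducible (p + q) a b fuel prime))
    from : IsPPF-K p q fp fq → (fp , fq) ∈ primeList
    -- Membership in the finite lists of words needs bounded labels, which `irreducible-bound`
    -- provides.
    from ppf with fp≥1 , fq≥1 , irr ← fromK ppf = ∈-filter⁺ (T? ∘ φ)
      (∈-cartesianProduct⁺
        (∈-words⁺ fp fp≥1 (irreducible-bound a b (s≤s z≤n) (s≤s z≤n) (length-decrement fp) (length-decrement fq) irr))
        (∈-words⁺ fq fq≥1 (irreducible-bound b a (s≤s z≤n) (s≤s z≤n) (length-decrement fq) (length-decrement fp)
          (Irreducible-swap a b irr))))
      (irreducible⇒prime (p + q) a b
        (subst (1 ≤_) (sym (length-decrement fp)) (s≤s z≤n)) (subst (1 ≤_) (sym (length-decrement fq)) (s≤s z≤n)) fuel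
        (subst₂ (λ m n → Irreducible m n a b) (sym (length-decrement fp)) (sym (length-decrement fq)) irr))

  length-primeList : length primeList ≡ primes P Q p q refl refl
  length-primeList = begin
    length primeList
      ≡⟨ length-filter-T φ (cartesianProduct (words q p) (words p q)) ⟩
    sum (map (λ x → ⟦ φ x ⟧) (cartesianProduct (words q p) (words p q)))
      ≡⟨ sum-cartesianProductWith (λ x → ⟦ φ x ⟧) _,_ (words q p) (words p q) ⟩
    sum (map (λ fp → sum (map (λ fq → ⟦ φ (fp , fq) ⟧) (words p q))) (words q p))
      ≡⟨ cong sum (map-cong (λ fp → sum-words p q (λ b → ⟦ primeᵇ (p + q) (decrement fp) b ⟧)) (words q p)) ⟩
    sum (map (λ fp → ∑ p q λ b → ⟦ primeᵇ (p + q) (decrement fp) b ⟧) (words q p))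
      ≡⟨ sum-words q p (λ a → ∑ p q λ b → ⟦ primeᵇ (p + q) a b ⟧) ⟩
    primes P Q p q refl refl ∎
    where open ≡-Reasoning

theorem3p11 : (p q : ℕ) → 1 ≤ p → 1 ≤ q →
    ((fp : Vec ℕ p) (fq : Vec ℕ q) → (IsPPFpq p q fp fq ⇔ IsPPF-K p q fp fq))
    × (∃ λ (L : List (Vec ℕ p × Vec ℕ q)) →
    Unique L
    × ((fp : Vec ℕ p) (fq : Vec ℕ q) → ((fp , fq) ∈ L ⇔ IsPPF-K p q fp fq))
    × (+ length L ≡
    (+ (p ^ q * (q ∸ 1) ^ (p ∸ 1)) ℤ.+ + (q ^ p * (p ∸ 1) ^ (q ∸ 1)))
    - + ((p + q ∸ 1) * (p ∸ 1) ^ (q ∸ 1) * (q ∸ 1) ^ (p ∸ 1))))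
theorem3p11 p@(suc P) q@(suc Q) 1≤p 1≤q =
  (λ fp fq → mk⇔ (from (IsPPF-K⇔ 1≤p 1≤q fp fq) ∘ to (IsPPFpq⇔ 1≤p 1≤q fp fq))
                 (from (IsPPFpq⇔ 1≤p 1≤q fp fq) ∘ to (IsPPF-K⇔ 1≤p 1≤q fp fq))) ,
  primeList P Q , primeList-unique P Q , ∈-primeList P Q ,
  trans (cong +_ (length-primeList P Q)) (primes-count P Q)
  where open Equivalence
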